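{- Let $q$ be a distribution over $[n]$, let $S\subseteq[n]$ be nonempty with $R(q,S)\ge1$, let $0\le\varepsilon_1<\varepsilon_2$ and $\delta>0$. Then \[ \mathsf{SC}(q,\varepsilon_1,\varepsilon_2,\delta)\ \ge\ \frac{4}{q(S)}\cdot \mathsf{SC}\Big(\mathrm{Unif}_{R(q,S)},\ \frac{4\varepsilon_1}{q(S)},\ \frac{4\varepsilon_2}{q(S)},\ \delta\Big). \]
   Context: For a distribution $q$ over a finite domain, $0\le\varepsilon_1<\varepsilon_2$ and $\delta>0$, $\mathsf{SC}(q,\varepsilon_1,\varepsilon_2,\delta)$ denotes the minimum $m$ such that some tester, given $\mathrm{Poi}(m)$ i.i.d. samples (Poissonized sampling) from an unknown distribution $p$ on the same domain and the full description of $q$, correctly distinguishes $\|p-q\|_1\le\varepsilon_1$ from $\|p-q\|_1\ge\varepsilon_2$ with probability at least $1-\delta$ for every such $p$. For $S\subseteq[n]$, $q(S)=\sum_{i\in S}q_i$, $M(q,S)=\max_{i\in S}q_i$ and $R(q,S)=\big\lfloor \frac{q(S)}{2M(q,S)}\big\rfloor$. $\mathrm{Unif}_t$ is the uniform distribution on $[t]$. -}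

module Defs where

open import Algebra.Apartness.Structures using (IsHeytingField)
open import Algebra.Bundles using (CommutativeRing)
open import Algebra.Core using (Op₁; Op₂)
import Algebra.Properties.Ring as RingProperties
import Algebra.Properties.Semiring.Exp as SemiringExp
import Algebra.Properties.Semiring.Mult as SemiringMult
import Algebra.Properties.Semiring.Sum as SemiringSum
open import Data.Bool.Base using (if_then_else_; true; false)
open import Data.Fin.Base using (Fin; zero; suc; toℕ)
open import Data.Fin.Subset using (Subset)
open import Data.Nat.Base as ℕ using (ℕ; zero; suc; NonZero; _!)
open import Data.Nat.Properties using (_!≢0)
open import Data.Product.Base using (Σ-syntax; ∃-syntax; _×_; _,_; proj₁; proj₂)
open import Data.Sum.Base using (_⊎_; inj₁; inj₂; [_,_]′)
open import Data.Vec.Base using (Vec; []; _∷_; lookup)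
open import Data.Vec.Functional using (foldr)
open import Function.Base using (_∘_)
open import Level using (Level) renaming (_⊔_ to _⊔ˡ_; suc to sucˡ)
open import Relation.Binary.Core using (Rel)
open import Relation.Binary.Lattice.Definitions using (Supremum)
open import Relation.Binary.Structures using (IsStrictPartialOrder)
open import Relation.Nullary.Negation using (¬_; contradiction)
open import Relation.Unary using (Pred; _∈_; _⊆_)

-- The real numbers, as a Cauchy-complete Archimedean ordered field (in the
-- sense of the HoTT book, Definition 11.2.7: a field with a compatible strict
-- order that has binary maxima).  No decidability is assumed; classically
-- these axioms characterise ℝ up to unique isomorphism.

record Reals c ℓ₁ ℓ₂ : Set (sucˡ (c ⊔ˡ ℓ₁ ⊔ˡ ℓ₂)) where
  infix  8 -_
  infixl 7 _*_
  infixl 6 _+_ _⊔_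
  infix  4 _≈_ _<_ _#_ _≤_

  field
    Carrier : Set c
    _≈_     : Rel Carrier ℓ₁
    _<_     : Rel Carrier ℓ₂
    _+_ _*_ : Op₂ Carrier
    -_      : Op₁ Carrier
    0# 1#   : Carrier
    _⊔_     : Op₂ Carrier

  _#_ : Rel Carrier ℓ₂
  x # y = x < y ⊎ y < x

  _≤_ : Rel Carrier ℓ₂
  x ≤ y = ¬ y < x

  field
    isHeytingField       : IsHeytingField _≈_ _#_ _+_ _*_ -_ 0# 1#
    isStrictPartialOrder : IsStrictPartialOrder _≈_ _<_
    ⊔-supremum           : Supremum _≤_ _⊔_
    0<1                  : 0# < 1#
    +-monoˡ-<            : ∀ z {x y} → x < y → x + z < y + z
    *-pos                : ∀ {x y} → 0# < x → 0# < y → 0# < x * y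

  open IsHeytingField isHeytingField public renaming (zero to *-zero)
  open IsStrictPartialOrder isStrictPartialOrder public
    using (<-resp-≈; <-respˡ-≈; <-respʳ-≈)
    renaming (irrefl to <-irrefl; trans to <-trans; asym to <-asym)

  commutativeRing : CommutativeRing c ℓ₁
  commutativeRing = record { isCommutativeRing = isCommutativeRing }

  open CommutativeRing commutativeRing public using (semiring; ring)
  open SemiringMult semiring public using () renaming (_×_ to _×ⁿ_)

  fromℕ : ℕ → Carrier
  fromℕ k = k ×ⁿ 1#

  ∣_∣ : Carrier → Carrier
  ∣ x ∣ = x ⊔ - x

  infix 4 _⟶_

  _⟶_ : (ℕ → Carrier) → Carrier → Set (c ⊔ˡ ℓ₂)
  s ⟶ l = ∀ ε → 0# < ε → ∃[ N ] (∀ k → N ℕ.≤ k → ∣ s k - l ∣ < ε)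

  Cauchy : (ℕ → Carrier) → Set (c ⊔ˡ ℓ₂)
  Cauchy s = ∀ ε → 0# < ε →
    ∃[ N ] (∀ j k → N ℕ.≤ j → N ℕ.≤ k → ∣ s j - s k ∣ < ε)

  field
    archimedean : ∀ x → ∃[ k ] x < fromℕ k
    complete    : ∀ s → Cauchy s → ∃[ l ] s ⟶ l

module IdentityTesting {c ℓ₁ ℓ₂} (ℝ : Reals c ℓ₁ ℓ₂) where

  open Reals ℝ public
  open SemiringSum semiring public using (sum; sum-syntax; sum-replicate)
  open SemiringExp semiring public using (_^_)

  private
    module Mult = SemiringMult semiring
    module RP = RingProperties ring

  ≤-trans : ∀ {x y z} → x ≤ y → y ≤ z → x ≤ z
  ≤-trans {y = y} x≤y y≤z z<x with #-cotrans (inj₁ z<x) y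
  ... | inj₁ (inj₁ z<y) = y≤z z<y
  ... | inj₁ (inj₂ y<z) = x≤y (<-trans y<z z<x)
  ... | inj₂ (inj₁ y<x) = x≤y y<x
  ... | inj₂ (inj₂ x<y) = y≤z (<-trans z<x x<y)

  <-≤-trans : ∀ {x y z} → x < y → y ≤ z → x < z
  <-≤-trans {z = z} x<y y≤z with #-cotrans (inj₁ x<y) z
  ... | inj₁ (inj₁ x<z) = x<z
  ... | inj₁ (inj₂ z<x) = contradiction (<-trans z<x x<y) y≤z
  ... | inj₂ (inj₁ z<y) = contradiction z<y y≤z
  ... | inj₂ (inj₂ y<z) = <-trans x<y y<z

  ≤-refl : ∀ {x} → x ≤ x
  ≤-refl = <-irrefl refl

  fromℕ-pos : ∀ k .{{_ : NonZero k}} → 0# < fromℕ k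
  fromℕ-pos (suc zero)      = <-respʳ-≈ (sym (+-identityʳ 1#)) 0<1
  fromℕ-pos (suc k@(suc _)) =
    <-trans (fromℕ-pos k) (<-respˡ-≈ (+-identityˡ _) (+-monoˡ-< (fromℕ k) 0<1))

  inverse : ∀ x → 0# < x → ∃[ y ] x * y ≈ 1#
  inverse x 0<x with #⇒invertible (inj₂ 0<x)
  ... | y , _ , x-0*y≈1 = y , trans (*-congʳ (sym x-0≈x)) x-0*y≈1
    where
    x-0≈x : x - 0# ≈ x
    x-0≈x = trans (+-congˡ RP.-0#≈0#) (+-identityʳ x)

  infixl 7 _/_[_]

  _/_[_] : (x y : Carrier) → 0# < y → Carrier
  x / y [ 0<y ] = x * proj₁ (inverse y 0<y)

  _sumsTo_ : (ℕ → Carrier) → Carrier → Set (c ⊔ˡ ℓ₂)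
  a sumsTo s = (λ N → ∑[ k < N ] a (toℕ k)) ⟶ s

  expTerm : Carrier → ℕ → Carrier
  expTerm x k = x ^ k / fromℕ (k !) [ fromℕ-pos (k !) {{k !≢0}} ]

  IsExp : Carrier → Carrier → Set (c ⊔ˡ ℓ₂)
  IsExp x y = expTerm x sumsTo y

  -- e is the expectation of g(N) for N ∼ Poi(m), i.e. Σₖ e⁻ᵐ (mᵏ / k!) g(k).
  IsPoissonExpectation : Carrier → (ℕ → Carrier) → Carrier → Set (c ⊔ˡ ℓ₂)
  IsPoissonExpectation m g e =
    Σ[ w ∈ Carrier ] IsExp (- m) w × (λ k → w * expTerm m k * g k) sumsTo e

  record Distribution (n : ℕ) : Set (c ⊔ˡ ℓ₁ ⊔ˡ ℓ₂) where
    field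
      prob        : Fin n → Carrier
      nonnegative : ∀ i → 0# ≤ prob i
      total       : sum prob ≈ 1#

  open Distribution public

  ‖_-_‖₁ : ∀ {n} → Distribution n → Distribution n → Carrier
  ‖_-_‖₁ {n} p q = ∑[ i < n ] ∣ prob p i - prob q i ∣

  -- The expectation of f(x₁, …, xₖ) for k i.i.d. samples xᵢ ∼ p.
  𝔼 : ∀ {n} → Distribution n → ∀ k → (Vec (Fin n) k → Carrier) → Carrier
  𝔼         p zero    f = f []
  𝔼 {n = n} p (suc k) f = ∑[ i < n ] (prob p i * 𝔼 p k (λ xs → f (i ∷ xs)))

  Unif : ∀ t .{{_ : NonZero t}} → Distribution t
  Unif t = record
    { prob        = λ _ → 1/t
    ; nonnegative = λ _ → 1/t-nonneg
    ; total       = trans (sum-replicate t) t×1/t≈1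
    }
    where
    t⁻¹ = proj₁ (inverse (fromℕ t) (fromℕ-pos t))
    1/t = 1# / fromℕ t [ fromℕ-pos t ]

    t*1/t≈1 : fromℕ t * 1/t ≈ 1#
    t*1/t≈1 = trans (*-congˡ (*-identityˡ t⁻¹)) (proj₂ (inverse (fromℕ t) (fromℕ-pos t)))

    t×1/t≈1 : t ×ⁿ 1/t ≈ 1#
    t×1/t≈1 = trans (Mult.×-congʳ t (sym (*-identityˡ 1/t)))
                    (trans (sym (Mult.×-assoc-* t 1# 1/t)) t*1/t≈1)

    1/t-nonneg : 0# ≤ 1/t
    1/t-nonneg 1/t<0 = <-asym 0<1 1<0
      where
      0<-1/t : 0# < - 1/t
      0<-1/t = <-respˡ-≈ (-‿inverseʳ 1/t)
                 (<-respʳ-≈ (+-identityˡ (- 1/t)) (+-monoˡ-< (- 1/t) 1/t<0))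

      0<-1 : 0# < - 1#
      0<-1 = <-respʳ-≈ (trans (sym (RP.-‿distribʳ-* _ _)) (-‿cong t*1/t≈1))
               (*-pos (fromℕ-pos t) 0<-1/t)

      1<0 : 1# < 0#
      1<0 = <-respˡ-≈ (+-identityˡ 1#)
              (<-respʳ-≈ (-‿inverseˡ 1#) (+-monoˡ-< 1# 0<-1))

  -- A randomised tester is given by its probability of accepting on each
  -- sequence of samples, of whatever length.
  record Tester (n : ℕ) : Set (c ⊔ˡ ℓ₂) where
    field
      accept   : ∀ {k} → Vec (Fin n) k → Carrier
      accept≥0 : ∀ {k} (xs : Vec (Fin n) k) → 0# ≤ accept xs
      accept≤1 : ∀ {k} (xs : Vec (Fin n) k) → accept xs ≤ 1#

    reject : ∀ {k} → Vec (Fin n) k → Carrier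
    reject xs = 1# - accept xs

  open Tester public

  AcceptsWithProb : ∀ {n} → Tester n → Carrier → Distribution n → Carrier → Set (c ⊔ˡ ℓ₂)
  AcceptsWithProb T m p = IsPoissonExpectation m (λ k → 𝔼 p k (accept T))

  RejectsWithProb : ∀ {n} → Tester n → Carrier → Distribution n → Carrier → Set (c ⊔ˡ ℓ₂)
  RejectsWithProb T m p = IsPoissonExpectation m (λ k → 𝔼 p k (reject T))

  Distinguishes : ∀ {n} → Tester n → Carrier → Distribution n → (ε₁ ε₂ δ : Carrier) →
                  Set (c ⊔ˡ ℓ₁ ⊔ˡ ℓ₂)
  Distinguishes T m q ε₁ ε₂ δ = ∀ p →
    (‖ p - q ‖₁ ≤ ε₁ → Σ[ a ∈ Carrier ] AcceptsWithProb T m p a × 1# - δ ≤ a) ×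
    (ε₂ ≤ ‖ p - q ‖₁ → Σ[ r ∈ Carrier ] RejectsWithProb T m p r × 1# - δ ≤ r)

  -- The expected number m of samples is a nonnegative real, not only an integer.
  Suffices : ∀ {n} → Distribution n → (ε₁ ε₂ δ : Carrier) →
             Pred Carrier (c ⊔ˡ ℓ₁ ⊔ˡ ℓ₂)
  Suffices {n} q ε₁ ε₂ δ m = 0# ≤ m × (Σ[ T ∈ Tester n ] Distinguishes T m q ε₁ ε₂ δ)

  -- Infima are taken in the extended reals.  An extended real x is represented
  -- by the set of reals strictly above it, so that infima of arbitrary sets
  -- exist without choice (inf ∅ = ∞ is the empty set) and ≥ is inclusion.

  Extended : (ℓ : Level) → Set (c ⊔ˡ sucˡ ℓ)
  Extended ℓ = Pred Carrier ℓ

  inf : ∀ {ℓ} → Pred Carrier ℓ → Extended (c ⊔ˡ ℓ₂ ⊔ˡ ℓ)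
  inf A r = ∃[ m ] m ∈ A × m < r

  infix  4 _≽_
  infixr 7 _∙_

  _≽_ : ∀ {a b} → Extended a → Extended b → Set (c ⊔ˡ a ⊔ˡ b)
  x ≽ y = x ⊆ y

  -- Only meaningful for a factor κ > 0.
  _∙_ : ∀ {ℓ} → Carrier → Extended ℓ → Extended (c ⊔ˡ ℓ₁ ⊔ˡ ℓ)
  (κ ∙ x) r = ∃[ s ] s ∈ x × r ≈ κ * s

  -- The infimum is the least sufficient m whenever it is attained.
  SC : ∀ {n} → Distribution n → (ε₁ ε₂ δ : Carrier) → Extended (c ⊔ˡ ℓ₁ ⊔ˡ ℓ₂)
  SC q ε₁ ε₂ δ = inf (Suffices q ε₁ ε₂ δ)

  restrict : ∀ {n} → Distribution n → Subset n → Fin n → Carrier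
  restrict q S i = if lookup S i then prob q i else 0#

  mass : ∀ {n} → Distribution n → Subset n → Carrier
  mass q S = sum (restrict q S)

  -- As q is nonnegative, padding with 0 leaves the maximum over a nonempty S
  -- unchanged.
  M : ∀ {n} → Distribution n → Subset n → Carrier
  M q S = foldr _⊔_ 0# (restrict q S)

  IsFloor : Carrier → ℕ → Set ℓ₂
  IsFloor x k = fromℕ k ≤ x × x < fromℕ (suc k)

  -- R(q,S) is defined and equal to k; it is defined when M(q,S) > 0.
  IsR : ∀ {n} → Distribution n → Subset n → ℕ → Set ℓ₂
  IsR q S k = Σ[ 0<M ∈ 0# < M q S ]
    IsFloor (mass q S / (fromℕ 2 * M q S) [ *-pos (fromℕ-pos 2) 0<M ]) k

  x≤x+y : ∀ {x y} → 0# ≤ y → x ≤ x + y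
  x≤x+y {x} {y} 0≤y x+y<x = 0≤y
    (<-respˡ-≈ (trans (+-congʳ (+-comm x y))
                 (trans (+-assoc y x (- x)) (trans (+-congˡ (-‿inverseʳ x)) (+-identityʳ y))))
      (<-respʳ-≈ (-‿inverseʳ x) (+-monoˡ-< (- x) x+y<x)))

  x≤y+x : ∀ {x y} → 0# ≤ y → x ≤ y + x
  x≤y+x 0≤y y+x<x = x≤x+y 0≤y (<-respˡ-≈ (+-comm _ _) y+x<x)

  sum-nonneg : ∀ {n} (v : Fin n → Carrier) → (∀ i → 0# ≤ v i) → 0# ≤ sum v
  sum-nonneg {zero}  v 0≤v = ≤-refl
  sum-nonneg {suc n} v 0≤v =
    ≤-trans (0≤v zero) (x≤x+y (sum-nonneg (v ∘ suc) (0≤v ∘ suc)))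

  max≤sum : ∀ {n} (v : Fin n → Carrier) → (∀ i → 0# ≤ v i) → foldr _⊔_ 0# v ≤ sum v
  max≤sum {zero}  v 0≤v = ≤-refl
  max≤sum {suc n} v 0≤v = proj₂ (proj₂ (⊔-supremum _ _)) _
    (x≤x+y (sum-nonneg (v ∘ suc) (0≤v ∘ suc)))
    (≤-trans (max≤sum (v ∘ suc) (0≤v ∘ suc)) (x≤y+x (0≤v zero)))

  restrict-nonneg : ∀ {n} (q : Distribution n) S i → 0# ≤ restrict q S i
  restrict-nonneg q S i with lookup S i
  ... | true  = nonnegative q i
  ... | false = ≤-refl

  mass-pos : ∀ {n} (q : Distribution n) S k → IsR q S k → 0# < mass q S
  mass-pos q S _ (0<M , _) = <-≤-trans 0<M (max≤sum (restrict q S) (restrict-nonneg q S))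

module Submission where

-- A tester T for q with Poi(m) samples yields a tester for Unif R with
-- Poi(m θ) samples, θ = q(S)/4.  Elements of S weigh at most
-- M ≤ q(S)/(2R), so S contains R disjoint buckets of mass at least q(S)/(4R);
-- let w y be q conditioned on bucket y.  For p′ on [R] put
--   p = q + θ Σ_y (p′ y − 1/R) w y.
-- This is nonnegative by the lower bound on bucket masses, and as the buckets
-- are disjoint, ‖p − q‖₁ = θ ‖p′ − Unif R‖₁.  By Poisson splitting, Poi(m)
-- samples from p are a random interleaving of Poi(m θ) samples from p′, each
-- replaced by a sample from its bucket, with Poi(m (1 − θ)) samples from a
-- distribution that does not depend on p′.  The new tester therefore averages T
-- over the latter.  Its acceptance probability on p′ equals that of T on p, as
-- a nonnegative double series can be summed by rows or by antidiagonals.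

open import Defs
open import Algebra.Bundles using (CommutativeRing; RawRing)
import Algebra.Properties.CommutativeSemiring.Exp as CommutativeSemiringExp
import Algebra.Properties.Ring as RingProperties
import Algebra.Properties.Semiring.Exp as SemiringExp
import Algebra.Properties.Semiring.Mult as SemiringMult
import Algebra.Properties.Semiring.Mult.TCOptimised as OptimisedMult
import Algebra.Properties.Semiring.Sum as SemiringSum
import Algebra.Solver.Ring
open import Algebra.Solver.Ring.AlmostCommutativeRing
  using (AlmostCommutativeRing; fromCommutativeRing; _-Raw-AlmostCommutative⟶_)
open import Data.Bool.Base using (true; false)
open import Data.Fin.Base using (Fin; zero; suc; toℕ)
open import Data.Fin.Subset using (Subset; Nonempty)
open import Data.Maybe.Base as Maybe using (Maybe; just; nothing)
open import Data.Nat.Base as ℕ using (ℕ; zero; suc; NonZero; _!)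
import Data.Nat.Properties as ℕ
open import Data.Nat.Tactic.RingSolver using () renaming (solve-∀ to ℕ-solve-∀)
open import Data.Product.Base using (_×_; _,_; ∃-syntax; proj₁; proj₂)
open import Data.Sum.Base using (_⊎_; inj₁; inj₂)
open import Data.Vec.Base using (Vec; []; _∷_; lookup)
open import Data.Vec.Functional using (foldr)
open import Function.Base using (_∘_)
import Relation.Binary.Reasoning.Base.Triple as Triple
import Relation.Binary.Reasoning.Setoid as SetoidReasoning
open import Relation.Binary.PropositionalEquality as ≡ using (_≡_)
open import Relation.Binary.Structures using (IsPreorder)
open import Relation.Nullary.Decidable.Core using (yes; no)
open import Relation.Nullary.Negation using (¬_; contradiction)

-- The order is not decidable and `_≤_` is a negated `_<_`. Hence signs are discussed only where the
-- goal is a negation, and greedy filling can only compare with two separated thresholds: a bucket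
-- closes at mass above q(S)/(4R) and stays open below q(S)/(2R). A decidable order would give
-- buckets of mass at least q(S)/(2R), so one factor 2 of the constant 4 absorbs this gap. The value
-- of θ is then forced by the worst case: where p′ vanishes, the bucket loses mass θ/R, which must
-- not exceed the guaranteed q(S)/(4R).
--
-- The number of noise samples is unbounded, so the acceptance probability of the new tester is an
-- infinite series, a real number only by completeness. Likewise `IsPoissonExpectation` asks for a
-- convergent series and for a value of exp, so the convergence and the functional equation of the
-- exponential series are established along the way. The series for exp of a negative number has
-- terms of both signs, so its product formula needs a domination argument, whereas the double
-- series of the tester is nonnegative and needs only monotonicity.

module _ {c ℓ₁ ℓ₂} (ℝ : Reals c ℓ₁ ℓ₂) where

  open IdentityTesting ℝ
  private
    module RP = RingProperties ring
    module Sum = SemiringSum semiring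
    module Mult = SemiringMult semiring
    module OMult = OptimisedMult semiring
    module Exp = SemiringExp semiring
    module CExp = CommutativeSemiringExp (CommutativeRing.commutativeSemiring commutativeRing)

  -- Ring solver with integer coefficients

  module IntegerSolver where

    -- (a , b) stands for the integer a − b.
    ⟦_⟧ℤ : ℕ × ℕ → Carrier
    ⟦ a , zero ⟧ℤ  = a OMult.× 1#
    ⟦ a , suc b ⟧ℤ = a OMult.× 1# - suc b OMult.× 1#

    -- The case split in `⟦_⟧ℤ` makes `con (0 , 0)` and `con (1 , 0)` compute to `0#` and `1#`; this
    -- recovers the uniform reading.
    ⟦⟧ℤ-def : ∀ a b → ⟦ a , b ⟧ℤ ≈ fromℕ a - fromℕ b
    ⟦⟧ℤ-def a zero =
      trans (sym (OMult.×ᵤ≈× a 1#)) (trans (sym (+-identityʳ _)) (+-congˡ (sym RP.-0#≈0#)))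
    ⟦⟧ℤ-def a (suc b) =
      +-cong (sym (OMult.×ᵤ≈× a 1#)) (-‿cong (sym (OMult.×ᵤ≈× (suc b) 1#)))

    -- Cancelling keeps one component zero, a normal form that lets `equal?` compare coefficients
    -- syntactically.
    reduce : ℕ → ℕ → ℕ × ℕ
    reduce (suc a) (suc b) = reduce a b
    reduce a       b       = a , b

    integers : RawRing _ _
    integers = record
      { Carrier = ℕ × ℕ
      ; _≈_     = _≡_
      ; _+_     = λ { (a , b) (c , d) → reduce (a ℕ.+ c) (b ℕ.+ d) }
      ; _*_     = λ { (a , b) (c , d) → reduce (a ℕ.* c ℕ.+ b ℕ.* d) (a ℕ.* d ℕ.+ b ℕ.* c) }
      ; -_      = λ { (a , b) → b , a }
      ; 0#      = 0 , 0
      ; 1#      = 1 , 0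
      }

    acr : AlmostCommutativeRing _ _
    acr = fromCommutativeRing commutativeRing

    open SetoidReasoning setoid

    interchange : ∀ a b c d → (a + b) + (c + d) ≈ (a + c) + (b + d)
    interchange a b c d = begin
      (a + b) + (c + d) ≈⟨ +-assoc a b (c + d) ⟩
      a + (b + (c + d)) ≈⟨ +-congˡ (+-assoc b c d) ⟨
      a + ((b + c) + d) ≈⟨ +-congˡ (+-congʳ (+-comm b c)) ⟩
      a + ((c + b) + d) ≈⟨ +-congˡ (+-assoc c b d) ⟩
      a + (c + (b + d)) ≈⟨ +-assoc a c (b + d) ⟨
      (a + c) + (b + d) ∎

    -‿+ : ∀ x y → - (x + y) ≈ - x + - y
    -‿+ x y = sym (AlmostCommutativeRing.-‿+-comm acr x y)

    difference-+ : ∀ a b c d → (a + c) - (b + d) ≈ (a - b) + (c - d)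
    difference-+ a b c d = trans (+-congˡ (-‿+ b d)) (interchange a c (- b) (- d))

    ⟦reduce⟧ : ∀ a b → ⟦ reduce a b ⟧ℤ ≈ fromℕ a - fromℕ b
    ⟦reduce⟧ zero    b       = ⟦⟧ℤ-def 0 b
    ⟦reduce⟧ (suc a) zero    = ⟦⟧ℤ-def (suc a) 0
    ⟦reduce⟧ (suc a) (suc b) = begin
      ⟦ reduce a b ⟧ℤ                     ≈⟨ ⟦reduce⟧ a b ⟩
      fromℕ a - fromℕ b                   ≈⟨ +-identityˡ _ ⟨
      0# + (fromℕ a - fromℕ b)            ≈⟨ +-congʳ (-‿inverseʳ 1#) ⟨
      (1# - 1#) + (fromℕ a - fromℕ b)     ≈⟨ difference-+ 1# 1# (fromℕ a) (fromℕ b) ⟨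
      fromℕ (suc a) - fromℕ (suc b)       ∎

    difference-* : ∀ a b c d →
      (a * c + b * d) - (a * d + b * c) ≈ (a - b) * (c - d)
    difference-* a b c d = begin
      (a * c + b * d) - (a * d + b * c)           ≈⟨ +-congˡ (-‿cong (+-comm _ _)) ⟩
      (a * c + b * d) - (b * c + a * d)           ≈⟨ difference-+ _ _ _ _ ⟩
      (a * c - b * c) + (b * d - a * d)           ≈⟨ +-cong (RP.[y-z]x≈yx-zx c a b) lemma ⟨
      (a - b) * c + - ((a - b) * d)               ≈⟨ RP.x[y-z]≈xy-xz (a - b) c d ⟨
      (a - b) * (c - d)                           ∎
      where
      lemma : - ((a - b) * d) ≈ b * d - a * d
      lemma = trans (-‿cong (RP.[y-z]x≈yx-zx d a b)) (RP.⁻¹-anti-homo-// _ _)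

    ℤ⟶ℝ : integers -Raw-AlmostCommutative⟶ acr
    ℤ⟶ℝ = record
      { ⟦_⟧    = ⟦_⟧ℤ
      ; +-homo = λ { (a , b) (c , d) → begin
          ⟦ reduce (a ℕ.+ c) (b ℕ.+ d) ⟧ℤ                 ≈⟨ ⟦reduce⟧ (a ℕ.+ c) (b ℕ.+ d) ⟩
          fromℕ (a ℕ.+ c) - fromℕ (b ℕ.+ d)               ≈⟨ +-cong (Mult.×-homo-+ 1# a c) (-‿cong (Mult.×-homo-+ 1# b d)) ⟩
          (fromℕ a + fromℕ c) - (fromℕ b + fromℕ d)       ≈⟨ difference-+ _ _ _ _ ⟩
          (fromℕ a - fromℕ b) + (fromℕ c - fromℕ d)       ≈⟨ +-cong (⟦⟧ℤ-def a b) (⟦⟧ℤ-def c d) ⟨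
          ⟦ a , b ⟧ℤ + ⟦ c , d ⟧ℤ                         ∎ }
      ; *-homo = λ { (a , b) (c , d) → begin
          ⟦ reduce (a ℕ.* c ℕ.+ b ℕ.* d) (a ℕ.* d ℕ.+ b ℕ.* c) ⟧ℤ
            ≈⟨ ⟦reduce⟧ (a ℕ.* c ℕ.+ b ℕ.* d) (a ℕ.* d ℕ.+ b ℕ.* c) ⟩
          fromℕ (a ℕ.* c ℕ.+ b ℕ.* d) - fromℕ (a ℕ.* d ℕ.+ b ℕ.* c)
            ≈⟨ +-cong (sum-of-products a c b d) (-‿cong (sum-of-products a d b c)) ⟩
          (fromℕ a * fromℕ c + fromℕ b * fromℕ d) - (fromℕ a * fromℕ d + fromℕ b * fromℕ c)
            ≈⟨ difference-* _ _ _ _ ⟩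
          (fromℕ a - fromℕ b) * (fromℕ c - fromℕ d)
            ≈⟨ *-cong (⟦⟧ℤ-def a b) (⟦⟧ℤ-def c d) ⟨
          ⟦ a , b ⟧ℤ * ⟦ c , d ⟧ℤ ∎ }
      ; -‿homo = λ { (a , b) → begin
          ⟦ b , a ⟧ℤ                ≈⟨ ⟦⟧ℤ-def b a ⟩
          fromℕ b - fromℕ a         ≈⟨ RP.⁻¹-anti-homo-// _ _ ⟨
          - (fromℕ a - fromℕ b)     ≈⟨ -‿cong (⟦⟧ℤ-def a b) ⟨
          - ⟦ a , b ⟧ℤ              ∎ }
      ; 0-homo = refl
      ; 1-homo = refl
      }
      where
      sum-of-products : ∀ a c b d →
        fromℕ (a ℕ.* c ℕ.+ b ℕ.* d) ≈ fromℕ a * fromℕ c + fromℕ b * fromℕ d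
      sum-of-products a c b d = trans (Mult.×-homo-+ 1# (a ℕ.* c) (b ℕ.* d))
        (+-cong (Mult.×1-homo-* a c) (Mult.×1-homo-* b d))

    equal? : ∀ x y → Maybe (⟦ x ⟧ℤ ≈ ⟦ y ⟧ℤ)
    equal? (a , b) (c , d) with a ℕ.≟ c | b ℕ.≟ d
    ... | yes ≡.refl | yes ≡.refl = just refl
    ... | _          | _          = nothing

    open Algebra.Solver.Ring integers acr ℤ⟶ℝ equal? public
      using (solve; con; _:+_; _:*_; _:-_; :-_; _:=_)

  open IntegerSolver using (solve; con; _:+_; _:*_; _:-_; :-_; _:=_)

  -- Order

  <⇒≤ : ∀ {x y} → x < y → x ≤ y
  <⇒≤ x<y y<x = <-asym x<y y<x

  ≤-reflexive : ∀ {x y} → x ≈ y → x ≤ y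
  ≤-reflexive x≈y y<x = <-irrefl (sym x≈y) y<x

  ≤-<-trans : ∀ {x y z} → x ≤ y → y < z → x < z
  ≤-<-trans {x} x≤y y<z with #-cotrans (inj₁ y<z) x
  ... | inj₁ (inj₁ y<x) = contradiction y<x x≤y
  ... | inj₁ (inj₂ x<y) = <-trans x<y y<z
  ... | inj₂ (inj₁ x<z) = x<z
  ... | inj₂ (inj₂ z<x) = contradiction (<-trans y<z z<x) x≤y

  ≤-antisym : ∀ {x y} → x ≤ y → y ≤ x → x ≈ y
  ≤-antisym {x} {y} x≤y y≤x = proj₁ (tight x y) λ { (inj₁ x<y) → y≤x x<y ; (inj₂ y<x) → x≤y y<x }

  -- The constructive stand-in for a comparison test; bucket filling branches on it.
  <-cotrans : ∀ {x y} → x < y → ∀ z → x < z ⊎ z < y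
  <-cotrans x<y z with #-cotrans (inj₁ x<y) z
  ... | inj₁ (inj₁ x<z) = inj₁ x<z
  ... | inj₁ (inj₂ z<x) = inj₂ (<-trans z<x x<y)
  ... | inj₂ (inj₁ z<y) = inj₂ z<y
  ... | inj₂ (inj₂ y<z) = inj₁ (<-trans x<y y<z)

  ≤-isPreorder : IsPreorder _≈_ _≤_
  ≤-isPreorder = record
    { isEquivalence = isEquivalence
    ; reflexive     = ≤-reflexive
    ; trans         = ≤-trans
    }

  module ≤-Reasoning = Triple ≤-isPreorder <-asym <-trans <-resp-≈ <⇒≤ <-≤-trans ≤-<-trans

  ≤-respˡ-≈ : ∀ {x y z} → x ≈ y → x ≤ z → y ≤ z
  ≤-respˡ-≈ x≈y = ≤-trans (≤-reflexive (sym x≈y))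

  ≤-respʳ-≈ : ∀ {x y z} → x ≈ y → z ≤ x → z ≤ y
  ≤-respʳ-≈ x≈y z≤x = ≤-trans z≤x (≤-reflexive x≈y)

  0≤1 : 0# ≤ 1#
  0≤1 = <⇒≤ 0<1

  +-monoʳ-< : ∀ z {x y} → x < y → z + x < z + y
  +-monoʳ-< z x<y = <-respˡ-≈ (+-comm _ z) (<-respʳ-≈ (+-comm _ z) (+-monoˡ-< z x<y))

  +-cancelʳ-< : ∀ z {x y} → x + z < y + z → x < y
  +-cancelʳ-< z {x} {y} x+z<y+z = <-respˡ-≈ (eq x z) (<-respʳ-≈ (eq y z) (+-monoˡ-< (- z) x+z<y+z))
    where
    eq : ∀ x z → x + z - z ≈ x
    eq = solve 2 (λ x z → x :+ z :- z := x) refl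

  +-monoˡ-≤ : ∀ z {x y} → x ≤ y → x + z ≤ y + z
  +-monoˡ-≤ z x≤y y+z<x+z = x≤y (+-cancelʳ-< z y+z<x+z)

  +-monoʳ-≤ : ∀ z {x y} → x ≤ y → z + x ≤ z + y
  +-monoʳ-≤ z x≤y = ≤-respˡ-≈ (+-comm _ z) (≤-respʳ-≈ (+-comm _ z) (+-monoˡ-≤ z x≤y))

  +-mono-≤ : ∀ {x y u v} → x ≤ y → u ≤ v → x + u ≤ y + v
  +-mono-≤ {y = y} {u} x≤y u≤v = ≤-trans (+-monoˡ-≤ u x≤y) (+-monoʳ-≤ y u≤v)

  +-nonneg : ∀ {x y} → 0# ≤ x → 0# ≤ y → 0# ≤ x + y
  +-nonneg 0≤x 0≤y = ≤-trans 0≤x (x≤x+y 0≤y)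

  x≤y⇒0≤y-x : ∀ {x y} → x ≤ y → 0# ≤ y - x
  x≤y⇒0≤y-x {x} x≤y = ≤-respˡ-≈ (-‿inverseʳ x) (+-monoˡ-≤ (- x) x≤y)

  ≤-by : ∀ {x y z} → 0# ≤ z → y ≈ x + z → x ≤ y
  ≤-by 0≤z y≈x+z = ≤-respʳ-≈ (sym y≈x+z) (x≤x+y 0≤z)

  x<y⇒0<y-x : ∀ {x y} → x < y → 0# < y - x
  x<y⇒0<y-x {x} x<y = <-respˡ-≈ (-‿inverseʳ x) (+-monoˡ-< (- x) x<y)

  <-by : ∀ {x y z} → 0# < z → y ≈ x + z → x < y
  <-by {x} 0<z y≈x+z = <-respˡ-≈ (+-identityʳ x) (<-respʳ-≈ (sym y≈x+z) (+-monoʳ-< x 0<z))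

  neg-mono-≤ : ∀ {x y} → x ≤ y → - y ≤ - x
  neg-mono-≤ {x} {y} x≤y = ≤-by (x≤y⇒0≤y-x x≤y)
    (solve 2 (λ x y → :- x := :- y :+ (y :- x)) refl x y)

  x<0⇒0<-x : ∀ {x} → x < 0# → 0# < - x
  x<0⇒0<-x {x} x<0 = <-respʳ-≈ (+-identityˡ (- x)) (x<y⇒0<y-x x<0)

  0≤x+x⇒0≤x : ∀ {x} → 0# ≤ x + x → 0# ≤ x
  0≤x+x⇒0≤x 0≤x+x x<0 = 0≤x+x (<-trans (<-respʳ-≈ (+-identityˡ _) (+-monoˡ-< _ x<0)) x<0)

  -- The goal is a negation, so both factors may be assumed positive: a factor that is not positive
  -- is zero, and so is the product.
  *-nonneg : ∀ {x y} → 0# ≤ x → 0# ≤ y → 0# ≤ x * y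
  *-nonneg {x} {y} 0≤x 0≤y xy<0 = ¬0<x λ 0<x → ¬0<y λ 0<y → <-asym xy<0 (*-pos 0<x 0<y)
    where
    ¬0<x : ¬ ¬ 0# < x
    ¬0<x x≤0 = <-irrefl (trans (*-congʳ (≤-antisym x≤0 0≤x)) (zeroˡ y)) xy<0
    ¬0<y : ¬ ¬ 0# < y
    ¬0<y y≤0 = <-irrefl (trans (*-congˡ (≤-antisym y≤0 0≤y)) (zeroʳ x)) xy<0

  *-monoʳ-≤ : ∀ {z x y} → 0# ≤ z → x ≤ y → z * x ≤ z * y
  *-monoʳ-≤ {z} {x} {y} 0≤z x≤y = ≤-by (*-nonneg 0≤z (x≤y⇒0≤y-x x≤y))
    (solve 3 (λ x y z → z :* y := z :* x :+ z :* (y :- x)) refl x y z)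

  *-monoˡ-≤ : ∀ {z x y} → 0# ≤ z → x ≤ y → x * z ≤ y * z
  *-monoˡ-≤ {z} 0≤z x≤y = ≤-respˡ-≈ (*-comm z _) (≤-respʳ-≈ (*-comm z _) (*-monoʳ-≤ 0≤z x≤y))

  *-monoʳ-< : ∀ {z x y} → 0# < z → x < y → z * x < z * y
  *-monoʳ-< {z} {x} {y} 0<z x<y = <-by (*-pos 0<z (x<y⇒0<y-x x<y))
    (solve 3 (λ x y z → z :* y := z :* x :+ z :* (y :- x)) refl x y z)

  *-monoˡ-< : ∀ {z x y} → 0# < z → x < y → x * z < y * z
  *-monoˡ-< {z} 0<z x<y = <-respˡ-≈ (*-comm z _) (<-respʳ-≈ (*-comm z _) (*-monoʳ-< 0<z x<y))

  *-cancelˡ-≤ : ∀ {z x y} → 0# < z → z * x ≤ z * y → x ≤ y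
  *-cancelˡ-≤ 0<z zx≤zy y<x = zx≤zy (*-monoʳ-< 0<z y<x)

  square-nonneg : ∀ x → 0# ≤ x * x
  square-nonneg x xx<0 = <-irrefl (trans (*-congʳ x≈0) (zeroˡ x)) xx<0
    where
    x≈0 : x ≈ 0#
    x≈0 = ≤-antisym
      (λ 0<x → <-asym xx<0 (*-pos 0<x 0<x))
      (λ x<0 → <-asym xx<0 (<-respʳ-≈ (solve 1 (λ x → (:- x) :* (:- x) := x :* x) refl x)
                                      (*-pos (x<0⇒0<-x x<0) (x<0⇒0<-x x<0))))

  -- Reciprocals

  infix 9 _⁻¹[_]

  _⁻¹[_] : ∀ x → 0# < x → Carrier
  x ⁻¹[ 0<x ] = proj₁ (inverse x 0<x)

  *-⁻¹ : ∀ x 0<x → x * x ⁻¹[ 0<x ] ≈ 1#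
  *-⁻¹ x 0<x = proj₂ (inverse x 0<x)

  inverse-pos : ∀ {x y} → x * y ≈ 1# → 0# < x → 0# < y
  inverse-pos {x} {y} xy≈1 0<x with invertible⇒# {y} {0#} (x , trans (*-congˡ y-0≈y) xy≈1 , trans (*-congʳ y-0≈y) (trans (*-comm y x) xy≈1))
    where
    y-0≈y : y - 0# ≈ y
    y-0≈y = trans (+-congˡ RP.-0#≈0#) (+-identityʳ y)
  ... | inj₂ 0<y = 0<y
  ... | inj₁ y<0 = contradiction
    (<-trans 0<1 (<-respˡ-≈ xy≈1 (<-respʳ-≈ (zeroʳ x) (*-monoʳ-< 0<x y<0))))
    (<-irrefl refl)

  ⁻¹-pos : ∀ x 0<x → 0# < x ⁻¹[ 0<x ]
  ⁻¹-pos x 0<x = inverse-pos (*-⁻¹ x 0<x) 0<x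

  ½ : Carrier
  ½ = fromℕ 2 ⁻¹[ fromℕ-pos 2 ]

  0<½ : 0# < ½
  0<½ = ⁻¹-pos (fromℕ 2) (fromℕ-pos 2)

  ½+½≈1 : ½ + ½ ≈ 1#
  ½+½≈1 = trans (solve 1 (λ h → h :+ h := (con (1 , 0) :+ (con (1 , 0) :+ con (0 , 0))) :* h) refl ½)
    (*-⁻¹ (fromℕ 2) (fromℕ-pos 2))

  halves : ∀ x → x * ½ + x * ½ ≈ x
  halves x = trans (sym (distribˡ x ½ ½)) (trans (*-congˡ ½+½≈1) (*-identityʳ x))

  halve-pos : ∀ {x} → 0# < x → 0# < x * ½
  halve-pos 0<x = *-pos 0<x 0<½

  fromℕ-nonneg : ∀ k → 0# ≤ fromℕ k
  fromℕ-nonneg zero    = ≤-refl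
  fromℕ-nonneg (suc k) = +-nonneg 0≤1 (fromℕ-nonneg k)

  fromℕ-mono-≤ : ∀ {j k} → j ℕ.≤ k → fromℕ j ≤ fromℕ k
  fromℕ-mono-≤ {k = k} ℕ.z≤n = fromℕ-nonneg k
  fromℕ-mono-≤ (ℕ.s≤s j≤k) = +-monoʳ-≤ 1# (fromℕ-mono-≤ j≤k)

  fromℕ-* : ∀ j k → fromℕ (j ℕ.* k) ≈ fromℕ j * fromℕ k
  fromℕ-* = Mult.×1-homo-*

  fromℕ-+ : ∀ j k → fromℕ (j ℕ.+ k) ≈ fromℕ j + fromℕ k
  fromℕ-+ = Mult.×-homo-+ 1#

  -- Absolute values

  x≤∣x∣ : ∀ x → x ≤ ∣ x ∣
  x≤∣x∣ x = proj₁ (⊔-supremum x (- x))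

  -x≤∣x∣ : ∀ x → - x ≤ ∣ x ∣
  -x≤∣x∣ x = proj₁ (proj₂ (⊔-supremum x (- x)))

  ∣∣-least : ∀ {x z} → x ≤ z → - x ≤ z → ∣ x ∣ ≤ z
  ∣∣-least {x} = proj₂ (proj₂ (⊔-supremum x (- x))) _

  -- The axioms give `_⊔_` only as a supremum, so its congruence is drawn from the universal
  -- property.
  ∣∣-mono-≈ : ∀ {x y} → x ≈ y → ∣ x ∣ ≤ ∣ y ∣
  ∣∣-mono-≈ {x} {y} x≈y = ∣∣-least (≤-respˡ-≈ (sym x≈y) (x≤∣x∣ y)) (≤-respˡ-≈ (-‿cong (sym x≈y)) (-x≤∣x∣ y))

  ∣∣-cong : ∀ {x y} → x ≈ y → ∣ x ∣ ≈ ∣ y ∣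
  ∣∣-cong x≈y = ≤-antisym (∣∣-mono-≈ x≈y) (∣∣-mono-≈ (sym x≈y))

  ∣∣-nonneg : ∀ x → 0# ≤ ∣ x ∣
  ∣∣-nonneg x = 0≤x+x⇒0≤x (≤-respˡ-≈ (-‿inverseʳ x) (+-mono-≤ (x≤∣x∣ x) (-x≤∣x∣ x)))

  0≤x⇒∣x∣≈x : ∀ {x} → 0# ≤ x → ∣ x ∣ ≈ x
  0≤x⇒∣x∣≈x {x} 0≤x = ≤-antisym (∣∣-least ≤-refl (≤-trans (neg-mono-≤ 0≤x) (≤-respˡ-≈ (sym RP.-0#≈0#) 0≤x))) (x≤∣x∣ x)

  ∣-x∣≈∣x∣ : ∀ x → ∣ - x ∣ ≈ ∣ x ∣
  ∣-x∣≈∣x∣ x = ≤-antisym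
    (∣∣-least (-x≤∣x∣ x) (≤-respˡ-≈ (sym (RP.-‿involutive x)) (x≤∣x∣ x)))
    (∣∣-least (≤-respˡ-≈ (RP.-‿involutive x) (-x≤∣x∣ (- x))) (x≤∣x∣ (- x)))

  ∣x-y∣≈∣y-x∣ : ∀ x y → ∣ x - y ∣ ≈ ∣ y - x ∣
  ∣x-y∣≈∣y-x∣ x y = trans (∣∣-cong (solve 2 (λ x y → x :- y := :- (y :- x)) refl x y)) (∣-x∣≈∣x∣ (y - x))

  ∣x+y∣≤ : ∀ {x y a b} → ∣ x ∣ ≤ a → ∣ y ∣ ≤ b → ∣ x + y ∣ ≤ a + b
  ∣x+y∣≤ {x} {y} ∣x∣≤a ∣y∣≤b = ∣∣-least
    (+-mono-≤ (≤-trans (x≤∣x∣ x) ∣x∣≤a) (≤-trans (x≤∣x∣ y) ∣y∣≤b))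
    (≤-respˡ-≈ (solve 2 (λ x y → :- x :+ :- y := :- (x :+ y)) refl x y)
      (+-mono-≤ (≤-trans (-x≤∣x∣ x) ∣x∣≤a) (≤-trans (-x≤∣x∣ y) ∣y∣≤b)))

  -- No cases on signs: (a - x)(b + y) + (a + x)(b - y) = 2(ab - xy), and all four factors are
  -- nonnegative.
  ∣x∣≤a⇒∣y∣≤b⇒xy≤ab : ∀ {x y a b} → ∣ x ∣ ≤ a → ∣ y ∣ ≤ b → x * y ≤ a * b
  ∣x∣≤a⇒∣y∣≤b⇒xy≤ab {x} {y} {a} {b} ∣x∣≤a ∣y∣≤b = ≤-by (0≤x+x⇒0≤x
    (≤-respʳ-≈ identity
      (+-nonneg (*-nonneg (0≤a-x ∣x∣≤a) (0≤a+x ∣y∣≤b))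
                (*-nonneg (0≤a+x ∣x∣≤a) (0≤a-x ∣y∣≤b)))))
    (solve 2 (λ p q → q := p :+ (q :- p)) refl (x * y) (a * b))
    where
    0≤a-x : ∀ {x a} → ∣ x ∣ ≤ a → 0# ≤ a - x
    0≤a-x {x} ∣x∣≤a = x≤y⇒0≤y-x (≤-trans (x≤∣x∣ x) ∣x∣≤a)
    0≤a+x : ∀ {x a} → ∣ x ∣ ≤ a → 0# ≤ a + x
    0≤a+x {x} {a} ∣x∣≤a = ≤-respʳ-≈ (solve 2 (λ x a → a :- (:- x) := a :+ x) refl x a)
      (x≤y⇒0≤y-x (≤-trans (-x≤∣x∣ x) ∣x∣≤a))
    identity : (a - x) * (b + y) + (a + x) * (b - y) ≈ (a * b - x * y) + (a * b - x * y)
    identity = solve 4 (λ x y a b → (a :- x) :* (b :+ y) :+ (a :+ x) :* (b :- y)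
      := (a :* b :- x :* y) :+ (a :* b :- x :* y)) refl x y a b

  ∣x*y∣≤ : ∀ {x y a b} → ∣ x ∣ ≤ a → ∣ y ∣ ≤ b → ∣ x * y ∣ ≤ a * b
  ∣x*y∣≤ {x} {y} ∣x∣≤a ∣y∣≤b = ∣∣-least
    (∣x∣≤a⇒∣y∣≤b⇒xy≤ab ∣x∣≤a ∣y∣≤b)
    (≤-respˡ-≈ (sym (RP.-‿distribˡ-* x y))
      (∣x∣≤a⇒∣y∣≤b⇒xy≤ab (≤-respˡ-≈ (sym (∣-x∣≈∣x∣ x)) ∣x∣≤a) ∣y∣≤b))

  -- The lower bound is a negation. Its failure refutes y < 0, hence gives y ≥ 0, and is then
  -- refuted in that case too.
  0≤x⇒∣x*y∣≈x*∣y∣ : ∀ {x} → 0# ≤ x → ∀ y → ∣ x * y ∣ ≈ x * ∣ y ∣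
  0≤x⇒∣x*y∣≈x*∣y∣ {x} 0≤x y = ≤-antisym (∣x*y∣≤ (≤-reflexive (0≤x⇒∣x∣≈x 0≤x)) ≤-refl) λ ∣xy∣<x∣y∣ →
    let
      0≤y : 0# ≤ y
      0≤y = λ y<0 → contradiction ∣xy∣<x∣y∣ (begin
        x * ∣ y ∣   ≈⟨ *-congˡ (∣-x∣≈∣x∣ y) ⟨
        x * ∣ - y ∣ ≈⟨ *-congˡ (0≤x⇒∣x∣≈x (<⇒≤ (x<0⇒0<-x y<0))) ⟩
        x * (- y)   ≈⟨ RP.-‿distribʳ-* x y ⟨
        - (x * y)   ≤⟨ -x≤∣x∣ (x * y) ⟩
        ∣ x * y ∣   ∎)
    in contradiction ∣xy∣<x∣y∣ (≤-trans (≤-reflexive (*-congˡ (0≤x⇒∣x∣≈x 0≤y))) (x≤∣x∣ (x * y)))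
    where open ≤-Reasoning

  -- Limits

  -- The successor makes the bound invertible, which |x| itself need not be.
  ∣_∣-bound : ∀ x → ∃[ k ] ∣ x ∣ ≤ fromℕ (suc k)
  ∣ x ∣-bound with archimedean ∣ x ∣
  ... | k , ∣x∣<k = k , ≤-trans (<⇒≤ ∣x∣<k) (x≤y+x 0≤1)

  ⟶-intro : ∀ {s l} → (∀ ε → 0# < ε → ∃[ N ] (∀ k → N ℕ.≤ k → ∣ s k - l ∣ ≤ ε)) → s ⟶ l
  ⟶-intro h ε 0<ε with h (ε * ½) (halve-pos 0<ε)
  ... | N , bound = N , λ k N≤k → ≤-<-trans (bound k N≤k)
    (<-by (halve-pos 0<ε) (sym (halves ε)))

  ⟶-cong : ∀ {s t l m} → (∀ k → s k ≈ t k) → l ≈ m → s ⟶ l → t ⟶ m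
  ⟶-cong s≈t l≈m s⟶l ε 0<ε with s⟶l ε 0<ε
  ... | N , bound = N , λ k N≤k → <-respˡ-≈ (∣∣-cong (+-cong (s≈t k) (-‿cong l≈m))) (bound k N≤k)

  ⟶-const : ∀ {s l} → (∀ k → s k ≈ l) → s ⟶ l
  ⟶-const {s} {l} s≈l ε 0<ε = 0 , λ k _ → ≤-<-trans
    (≤-reflexive (trans (0≤x⇒∣x∣≈x (≤-reflexive (sym (s-l≈0 k)))) (s-l≈0 k))) 0<ε
    where
    s-l≈0 : ∀ k → s k - l ≈ 0#
    s-l≈0 k = trans (+-congʳ (s≈l k)) (-‿inverseʳ l)

  ⟶-+ : ∀ {s t l m} → s ⟶ l → t ⟶ m → (λ k → s k + t k) ⟶ l + m
  ⟶-+ {s} {t} {l} {m} s⟶l t⟶m = ⟶-intro λ ε 0<ε →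
    let
      N₁ , bound₁ = s⟶l (ε * ½) (halve-pos 0<ε)
      N₂ , bound₂ = t⟶m (ε * ½) (halve-pos 0<ε)
    in N₁ ℕ.⊔ N₂ , λ k N≤k → ≤-respʳ-≈ (halves ε) (≤-respˡ-≈
      (∣∣-cong (solve 4 (λ s t l m → (s :- l) :+ (t :- m) := (s :+ t) :- (l :+ m)) refl (s k) (t k) l m))
      (∣x+y∣≤ (<⇒≤ (bound₁ k (ℕ.m⊔n≤o⇒m≤o N₁ N₂ N≤k))) (<⇒≤ (bound₂ k (ℕ.m⊔n≤o⇒n≤o N₁ N₂ N≤k)))))

  ⟶-* : ∀ x {s l} → s ⟶ l → (λ k → x * s k) ⟶ x * l
  ⟶-* x {s} {l} s⟶l with ∣ x ∣-bound
  ... | b , ∣x∣≤b = ⟶-intro λ ε 0<ε →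
    let
      B     = fromℕ (suc b)
      0<B   = fromℕ-pos (suc b)
      1/B   = B ⁻¹[ 0<B ]
      N , h = s⟶l (1/B * ε) (*-pos (⁻¹-pos B 0<B) 0<ε)
    in N , λ k N≤k → ≤-respˡ-≈
      (∣∣-cong (RP.x[y-z]≈xy-xz x (s k) l))
      (≤-respʳ-≈ (trans (sym (*-assoc B 1/B ε)) (trans (*-congʳ (*-⁻¹ B 0<B)) (*-identityˡ ε)))
        (∣x*y∣≤ ∣x∣≤b (<⇒≤ (h k N≤k))))

  ⟶-≤ : ∀ {s l x} N → s ⟶ l → (∀ k → N ℕ.≤ k → s k ≤ x) → l ≤ x
  ⟶-≤ {s} {l} {x} N s⟶l s≤x x<l with s⟶l (l - x) (x<y⇒0<y-x x<l)
  ... | N′ , h = contradiction (h k (ℕ.m≤n⊔m N N′)) (≤-trans (≤-by (x≤y⇒0≤y-x (s≤x k (ℕ.m≤m⊔n N N′)))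
      (solve 3 (λ l s x → :- (s :- l) := (l :- x) :+ (x :- s)) refl l (s k) x)) (-x≤∣x∣ (s k - l)))
    where k = N ℕ.⊔ N′

  ⟶-neg : ∀ {s l} → s ⟶ l → (λ k → - s k) ⟶ - l
  ⟶-neg s⟶l = ⟶-cong (λ k → RP.-1*x≈-x _) (RP.-1*x≈-x _) (⟶-* (- 1#) s⟶l)

  ⟶-≥ : ∀ {s l x} N → s ⟶ l → (∀ k → N ℕ.≤ k → x ≤ s k) → x ≤ l
  ⟶-≥ {s} {l} {x} N s⟶l x≤s = ≤-respˡ-≈ (RP.-‿involutive x) (≤-respʳ-≈ (RP.-‿involutive l)
    (neg-mono-≤ (⟶-≤ N (⟶-neg s⟶l) (λ k N≤k → neg-mono-≤ (x≤s k N≤k)))))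

  ⟶-monotone-≤ : ∀ {s t l m} → s ⟶ l → t ⟶ m → (∀ k → s k ≤ t k) → l ≤ m
  ⟶-monotone-≤ {s} {t} {l} {m} s⟶l t⟶m s≤t = ≤-by
    (⟶-≥ 0 (⟶-+ t⟶m (⟶-neg s⟶l)) (λ k _ → x≤y⇒0≤y-x (s≤t k)))
    (solve 2 (λ l m → m := l :+ (m :- l)) refl l m)

  ⟶-unique : ∀ {s l m} → s ⟶ l → s ⟶ m → l ≈ m
  ⟶-unique s⟶l s⟶m = ≤-antisym (⟶-monotone-≤ s⟶l s⟶m (λ _ → ≤-refl)) (⟶-monotone-≤ s⟶m s⟶l (λ _ → ≤-refl))

  ⟶-near : ∀ {s t l} →
    (∀ ε → 0# < ε → ∃[ N ] (∀ k → N ℕ.≤ k → ∣ t k - s k ∣ ≤ ε)) → s ⟶ l → t ⟶ l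
  ⟶-near {s} {t} {l} near s⟶l = ⟶-intro λ ε 0<ε →
    let
      N₁ , h₁ = near (ε * ½) (halve-pos 0<ε)
      N₂ , h₂ = s⟶l (ε * ½) (halve-pos 0<ε)
    in N₁ ℕ.⊔ N₂ , λ k N≤k → ≤-respʳ-≈ (halves ε) (≤-respˡ-≈
      (∣∣-cong (solve 3 (λ s t l → (t :- s) :+ (s :- l) := t :- l) refl (s k) (t k) l))
      (∣x+y∣≤ (h₁ k (ℕ.m⊔n≤o⇒m≤o N₁ N₂ N≤k)) (<⇒≤ (h₂ k (ℕ.m⊔n≤o⇒n≤o N₁ N₂ N≤k)))))

  ⟶⇒Cauchy : ∀ {s l} → s ⟶ l → Cauchy s
  ⟶⇒Cauchy {s} {l} s⟶l ε 0<ε with s⟶l ((ε * ½) * ½) (halve-pos (halve-pos 0<ε))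
  ... | N , h = N , λ j k N≤j N≤k → ≤-<-trans
    (≤-respʳ-≈ (halves (ε * ½)) (≤-respˡ-≈
      (∣∣-cong (solve 3 (λ s t l → (s :- l) :+ (l :- t) := s :- t) refl (s j) (s k) l))
      (∣x+y∣≤ (<⇒≤ (h j N≤j)) (≤-respˡ-≈ (∣x-y∣≈∣y-x∣ (s k) l) (<⇒≤ (h k N≤k))))))
    (<-by (halve-pos 0<ε) (sym (halves ε)))

  -- Series

  ∑< : ℕ → (ℕ → Carrier) → Carrier
  ∑< N a = ∑[ k < N ] a (toℕ k)

  ∑<-cong : ∀ N {a b} → (∀ k → a k ≈ b k) → ∑< N a ≈ ∑< N b
  ∑<-cong N a≈b = Sum.sum-cong-≋ {N} (λ k → a≈b (toℕ k))

  ∑<-snoc : ∀ N a → ∑< (suc N) a ≈ ∑< N a + a N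
  ∑<-snoc zero    a = +-comm (a 0) 0#
  ∑<-snoc (suc N) a = trans (+-congˡ (∑<-snoc N (a ∘ suc))) (sym (+-assoc _ _ _))

  ∑<-+ : ∀ N a b → ∑< N (λ k → a k + b k) ≈ ∑< N a + ∑< N b
  ∑<-+ N a b = Sum.∑-distrib-+ {N} (a ∘ toℕ) (b ∘ toℕ)

  ∑<-* : ∀ N x a → ∑< N (λ k → x * a k) ≈ x * ∑< N a
  ∑<-* N x a = sym (Sum.*-distribˡ-sum {N} x (a ∘ toℕ))

  sum-mono-≤ : ∀ {n} {u v : Fin n → Carrier} → (∀ i → u i ≤ v i) → sum u ≤ sum v
  sum-mono-≤ {zero}  u≤v = ≤-refl
  sum-mono-≤ {suc n} u≤v = +-mono-≤ (u≤v zero) (sum-mono-≤ (u≤v ∘ suc))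

  ∑<-mono-≤ : ∀ N {a b} → (∀ k → a k ≤ b k) → ∑< N a ≤ ∑< N b
  ∑<-mono-≤ N a≤b = sum-mono-≤ {N} (λ k → a≤b (toℕ k))

  ∑<-monoˡ-≤ : ∀ {M N a} → (∀ k → 0# ≤ a k) → M ℕ.≤ N → ∑< M a ≤ ∑< N a
  ∑<-monoˡ-≤ {N = N} {a} 0≤a ℕ.z≤n = sum-nonneg (a ∘ toℕ {N}) (λ k → 0≤a (toℕ k))
  ∑<-monoˡ-≤ {a = a} 0≤a (ℕ.s≤s M≤N) = +-monoʳ-≤ (a 0) (∑<-monoˡ-≤ (λ k → 0≤a (suc k)) M≤N)

  ∣∑<∣-≤ : ∀ {M N a} (u : ℕ → Carrier) → M ℕ.≤ N → (∀ k → ∣ a k ∣ ≤ u (suc k) - u k) →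
    ∣ ∑< N a - ∑< M a ∣ ≤ u N - u M
  ∣∑<∣-≤ {M} {a = a} u M≤N ∣a∣≤Δu = go (ℕ.≤⇒≤′ M≤N)
    where
    go : ∀ {N} → M ℕ.≤′ N → ∣ ∑< N a - ∑< M a ∣ ≤ u N - u M
    go (ℕ.≤′-reflexive ≡.refl) = ≤-reflexive (trans
      (∣∣-cong (-‿inverseʳ _)) (trans (0≤x⇒∣x∣≈x ≤-refl) (sym (-‿inverseʳ (u M)))))
    go {suc N} (ℕ.≤′-step M≤N) = begin
      ∣ ∑< (suc N) a - ∑< M a ∣      ≈⟨ ∣∣-cong (trans (+-congʳ (∑<-snoc N a))
        (solve 3 (λ x y z → (x :+ y) :- z := (x :- z) :+ y) refl (∑< N a) (a N) (∑< M a))) ⟩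
      ∣ (∑< N a - ∑< M a) + a N ∣    ≤⟨ ∣x+y∣≤ (go M≤N) (∣a∣≤Δu N) ⟩
      (u N - u M) + (u (suc N) - u N)
        ≈⟨ solve 3 (λ x y z → (y :- x) :+ (z :- y) := z :- x) refl (u M) (u N) (u (suc N)) ⟩
      u (suc N) - u M                ∎
      where open ≤-Reasoning

  -- Any `u` with large enough increments serves as majorant: partial sums in `dominated`, a closed
  -- form in `geometric-Cauchy`.
  comparison : ∀ {a} (u : ℕ → Carrier) → (∀ k → ∣ a k ∣ ≤ u (suc k) - u k) → Cauchy u → Cauchy (λ N → ∑< N a)
  comparison {a} u ∣a∣≤Δu cauchy ε 0<ε with cauchy ε 0<ε
  ... | N , h = N , bound
    where
    bound : ∀ j k → N ℕ.≤ j → N ℕ.≤ k → ∣ ∑< j a - ∑< k a ∣ < ε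
    bound j k N≤j N≤k with ℕ.≤-total j k
    ... | inj₁ j≤k = ≤-<-trans (≤-respˡ-≈ (∣x-y∣≈∣y-x∣ _ _) (≤-trans (∣∑<∣-≤ u j≤k ∣a∣≤Δu) (x≤∣x∣ _))) (h k j N≤k N≤j)
    ... | inj₂ k≤j = ≤-<-trans (≤-trans (∣∑<∣-≤ u k≤j ∣a∣≤Δu) (x≤∣x∣ _)) (h j k N≤j N≤k)

  ∑<-Δ : ∀ a k → ∑< (suc k) a - ∑< k a ≈ a k
  ∑<-Δ a k = trans (+-congʳ (∑<-snoc k a))
    (solve 2 (λ x y → (x :+ y) :- x := y) refl (∑< k a) (a k))

  ∣∑<∣-dominated : ∀ {M N a b} → M ℕ.≤ N → (∀ k → ∣ a k ∣ ≤ b k) →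
    ∣ ∑< N a - ∑< M a ∣ ≤ ∑< N b - ∑< M b
  ∣∑<∣-dominated {b = b} M≤N ∣a∣≤b = ∣∑<∣-≤ (λ N → ∑< N b) M≤N
    (λ k → ≤-respʳ-≈ (sym (∑<-Δ b k)) (∣a∣≤b k))

  dominated : ∀ {a b} → (∀ k → ∣ a k ∣ ≤ b k) → Cauchy (λ N → ∑< N b) → Cauchy (λ N → ∑< N a)
  dominated {b = b} ∣a∣≤b = comparison (λ N → ∑< N b)
    (λ k → ≤-respʳ-≈ (sym (∑<-Δ b k)) (∣a∣≤b k))

  partial≤total : ∀ {a l} → (∀ k → 0# ≤ a k) → a sumsTo l → ∀ N → ∑< N a ≤ l
  partial≤total 0≤a a⟶l N = ⟶-≥ N a⟶l (λ k N≤k → ∑<-monoˡ-≤ 0≤a N≤k)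

  -- Double series

  antidiagonal : (ℕ → ℕ → Carrier) → ℕ → Carrier
  antidiagonal g zero    = g 0 0
  antidiagonal g (suc K) = g 0 (suc K) + antidiagonal (g ∘ suc) K

  antidiagonal-nonneg : ∀ {g} K → (∀ k l → 0# ≤ g k l) → 0# ≤ antidiagonal g K
  antidiagonal-nonneg zero    0≤g = 0≤g 0 0
  antidiagonal-nonneg (suc K) 0≤g = +-nonneg (0≤g 0 (suc K)) (antidiagonal-nonneg K (0≤g ∘ suc))

  triangle : (ℕ → ℕ → Carrier) → ℕ → Carrier
  triangle g N = ∑< N (antidiagonal g)

  rectangle : (ℕ → ℕ → Carrier) → ℕ → ℕ → Carrier
  rectangle g N L = ∑< N (λ k → ∑< L (g k))

  -- Regroups diagonals into rows by peeling off row 0, so that triangles can be compared with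
  -- rectangles by induction on rows.
  triangle-suc : ∀ g N → triangle g (suc N) ≈ ∑< (suc N) (g 0) + triangle (g ∘ suc) N
  triangle-suc g N = trans (+-congˡ (∑<-+ N (g 0 ∘ suc) (antidiagonal (g ∘ suc)))) (sym (+-assoc _ _ _))

  triangle≤rectangle : ∀ {g N L} → (∀ k l → 0# ≤ g k l) → N ℕ.≤ L → triangle g N ≤ rectangle g N L
  triangle≤rectangle {N = zero} 0≤g N≤L = ≤-refl
  triangle≤rectangle {g} {suc N} 0≤g N≤L = ≤-respˡ-≈ (sym (triangle-suc g N))
    (+-mono-≤ (∑<-monoˡ-≤ (0≤g 0) N≤L) (triangle≤rectangle (0≤g ∘ suc) (ℕ.<⇒≤ N≤L)))

  rectangle≤triangle : ∀ {g} N L → (∀ k l → 0# ≤ g k l) → rectangle g N L ≤ triangle g (N ℕ.+ L)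
  rectangle≤triangle {g} zero L 0≤g = ∑<-monoˡ-≤ {0} {L} (λ K → antidiagonal-nonneg K 0≤g) ℕ.z≤n
  rectangle≤triangle {g} (suc N) L 0≤g = ≤-respʳ-≈ (sym (triangle-suc g (N ℕ.+ L)))
    (+-mono-≤ (∑<-monoˡ-≤ (0≤g 0) (ℕ.m≤n⇒m≤1+n (ℕ.m≤n+m L N))) (rectangle≤triangle N L (0≤g ∘ suc)))

  -- The difference sums `g` over the cells of the rectangle outside the triangle, where `b`
  -- dominates cell by cell. This handles terms of either sign in `exp-+`.
  ∣rectangle-triangle∣≤ : ∀ {g b N L} → N ℕ.≤ L → (∀ k l → ∣ g k l ∣ ≤ b k l) →
    ∣ rectangle g N L - triangle g N ∣ ≤ rectangle b N L - triangle b N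
  ∣rectangle-triangle∣≤ {N = zero} N≤L ∣g∣≤b = ≤-reflexive
    (0≤x⇒∣x∣≈x (≤-reflexive (sym (-‿inverseʳ 0#))))
  ∣rectangle-triangle∣≤ {g} {b} {suc N} {L} N≤L ∣g∣≤b = begin
    ∣ rectangle g (suc N) L - triangle g (suc N) ∣
      ≈⟨ ∣∣-cong (split g) ⟩
    ∣ (∑< L (g 0) - ∑< (suc N) (g 0)) + (rectangle (g ∘ suc) N L - triangle (g ∘ suc) N) ∣
      ≤⟨ ∣x+y∣≤ (∣∑<∣-dominated N≤L (∣g∣≤b 0)) (∣rectangle-triangle∣≤ (ℕ.<⇒≤ N≤L) (∣g∣≤b ∘ suc)) ⟩
    (∑< L (b 0) - ∑< (suc N) (b 0)) + (rectangle (b ∘ suc) N L - triangle (b ∘ suc) N)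
      ≈⟨ split b ⟨
    rectangle b (suc N) L - triangle b (suc N) ∎
    where
    open ≤-Reasoning
    split : ∀ g → rectangle g (suc N) L - triangle g (suc N) ≈
      (∑< L (g 0) - ∑< (suc N) (g 0)) + (rectangle (g ∘ suc) N L - triangle (g ∘ suc) N)
    split g = trans (+-congˡ (-‿cong (triangle-suc g N)))
      (solve 4 (λ x y z w → (x :+ y) :- (z :+ w) := (x :- z) :+ (y :- w)) refl
        (∑< L (g 0)) (rectangle (g ∘ suc) N L) (∑< (suc N) (g 0)) (triangle (g ∘ suc) N))

  -- Tonelli by squeezing: `triangle g N` ≤ `∑< N A` ≤ `l`, so the row sums converge at least as
  -- fast as the diagonals.
  sum-by-rows : ∀ {g A l} → (∀ k l → 0# ≤ g k l) → (∀ k → g k sumsTo A k) →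
    antidiagonal g sumsTo l → A sumsTo l
  sum-by-rows {g} {A} {l} 0≤g rows diagonals = λ ε 0<ε →
    let N , h = diagonals ε 0<ε in N , λ k N≤k → ≤-<-trans (closer k) (h k N≤k)
    where
    ∑<-rows : ∀ N → (λ L → rectangle g N L) ⟶ ∑< N A
    ∑<-rows N = go N g A rows
      where
      go : ∀ N g A → (∀ k → g k sumsTo A k) → (λ L → rectangle g N L) ⟶ ∑< N A
      go zero    g A rows = ⟶-const (λ _ → refl)
      go (suc N) g A rows = ⟶-+ (rows 0) (go N (g ∘ suc) (A ∘ suc) (rows ∘ suc))

    upper : ∀ N → ∑< N A ≤ l
    upper N = ⟶-≤ 0 (∑<-rows N) λ L _ →
      ⟶-≥ (N ℕ.+ L) diagonals (λ k N+L≤k → ≤-trans (rectangle≤triangle N L 0≤g) (triangle-mono N+L≤k))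
      where
      triangle-mono : ∀ {M N} → M ℕ.≤ N → triangle g M ≤ triangle g N
      triangle-mono = ∑<-monoˡ-≤ (λ K → antidiagonal-nonneg K 0≤g)

    lower : ∀ N → triangle g N ≤ ∑< N A
    lower N = ⟶-≥ N (∑<-rows N) (λ L N≤L → triangle≤rectangle 0≤g N≤L)

    closer : ∀ N → ∣ ∑< N A - l ∣ ≤ ∣ triangle g N - l ∣
    closer N = ∣∣-least
      (≤-trans (≤-by (x≤y⇒0≤y-x (upper N)) (solve 2 (λ x l → con (0 , 0) := (x :- l) :+ (l :- x)) refl (∑< N A) l))
        (∣∣-nonneg _))
      (≤-trans (≤-by (x≤y⇒0≤y-x (lower N)) (solve 3 (λ x t l → :- (t :- l) := :- (x :- l) :+ (x :- t)) refl (∑< N A) (triangle g N) l))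
        (-x≤∣x∣ _))

  antidiagonal-cong : ∀ {g h} → (∀ k l → g k l ≈ h k l) → ∀ K → antidiagonal g K ≈ antidiagonal h K
  antidiagonal-cong g≈h zero    = g≈h 0 0
  antidiagonal-cong g≈h (suc K) = +-cong (g≈h 0 (suc K)) (antidiagonal-cong (g≈h ∘ suc) K)

  antidiagonal-+ : ∀ g h K →
    antidiagonal (λ k l → g k l + h k l) K ≈ antidiagonal g K + antidiagonal h K
  antidiagonal-+ g h zero    = refl
  antidiagonal-+ g h (suc K) = trans (+-congˡ (antidiagonal-+ (g ∘ suc) (h ∘ suc) K))
    (IntegerSolver.interchange _ _ _ _)

  antidiagonal-* : ∀ (v : ℕ → Carrier) g K →
    antidiagonal (λ k l → v (k ℕ.+ l) * g k l) K ≈ v K * antidiagonal g K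
  antidiagonal-* v g zero    = refl
  antidiagonal-* v g (suc K) = trans (+-congˡ (antidiagonal-* (v ∘ suc) (g ∘ suc) K)) (sym (distribˡ _ _ _))

  antidiagonal-snoc : ∀ g K →
    antidiagonal g (suc K) ≈ antidiagonal (λ k l → g k (suc l)) K + g (suc K) 0
  antidiagonal-snoc g zero    = refl
  antidiagonal-snoc g (suc K) = trans (+-congˡ (antidiagonal-snoc (g ∘ suc) K)) (sym (+-assoc _ _ _))

  -- The product rule for power series, read off coefficients: in a cell with k + l = K + 1 the
  -- factor K + 1 splits as k + l, and the terms with factor 0 drop out.
  antidiagonal-Δ : ∀ g K → fromℕ (suc K) * antidiagonal g (suc K) ≈
    antidiagonal (λ k l → fromℕ (suc k) * g (suc k) l) K +
    antidiagonal (λ k l → fromℕ (suc l) * g k (suc l)) K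
  antidiagonal-Δ g zero = solve 2 (λ x y →
    (con (1 , 0) :+ con (0 , 0)) :* (x :+ y) := (con (1 , 0) :+ con (0 , 0)) :* y :+ (con (1 , 0) :+ con (0 , 0)) :* x)
    refl (g 0 1) (g 1 0)
  antidiagonal-Δ g (suc K) = begin
    fromℕ (suc (suc K)) * (a + (b + d))
      ≈⟨ solve 4 (λ n a b d → (con (1 , 0) :+ n) :* (a :+ (b :+ d)) :=
           (con (1 , 0) :+ n) :* a :+ (b :+ d) :+ n :* (b :+ d)) refl (fromℕ (suc K)) a b d ⟩
    fromℕ (suc (suc K)) * a + (b + d) + fromℕ (suc K) * (b + d)
      ≈⟨ +-congˡ (antidiagonal-Δ (g ∘ suc) K) ⟩
    fromℕ (suc (suc K)) * a + (b + d) + (x + y)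
      ≈⟨ solve 5 (λ a b d x y → a :+ (b :+ d) :+ (x :+ y) :=
           ((con (1 , 0) :+ con (0 , 0)) :* b :+ (d :+ x)) :+ (a :+ y)) refl (fromℕ (suc (suc K)) * a) b d x y ⟩
    (fromℕ 1 * b + (d + x)) + (fromℕ (suc (suc K)) * a + y)
      ≈⟨ +-congʳ (+-congˡ (sym (trans
           (antidiagonal-cong (λ k l → trans (distribʳ _ _ _) (+-congʳ (*-identityˡ _))) K)
           (antidiagonal-+ _ _ K)))) ⟩
    (fromℕ 1 * b + antidiagonal (λ k l → fromℕ (suc (suc k)) * g (suc (suc k)) l) K)
      + (fromℕ (suc (suc K)) * a + y) ∎
    where
    open SetoidReasoning setoid
    a = g 0 (suc (suc K))
    b = g 1 (suc K)
    d = antidiagonal (λ k l → g (suc (suc k)) l) K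
    x = antidiagonal (λ k l → fromℕ (suc k) * g (suc (suc k)) l) K
    y = antidiagonal (λ k l → fromℕ (suc l) * g (suc k) (suc l)) K

  -- The exponential series

  1/_! : ℕ → Carrier
  1/ k ! = fromℕ (k !) ⁻¹[ fromℕ-pos (k !) {{ℕ._!≢0 k}} ]

  k!*1/k! : ∀ k → fromℕ (k !) * 1/ k ! ≈ 1#
  k!*1/k! k = *-⁻¹ _ _

  1/k!-pos : ∀ k → 0# < 1/ k !
  1/k!-pos k = ⁻¹-pos _ _

  *-cancelˡ-≈ : ∀ {z x y} → 0# < z → z * x ≈ z * y → x ≈ y
  *-cancelˡ-≈ 0<z zx≈zy = ≤-antisym (*-cancelˡ-≤ 0<z (≤-reflexive zx≈zy)) (*-cancelˡ-≤ 0<z (≤-reflexive (sym zx≈zy)))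

  1/suc! : ∀ k → fromℕ (suc k) * 1/ (suc k) ! ≈ 1/ k !
  1/suc! k = *-cancelˡ-≈ (fromℕ-pos (k !) {{ℕ._!≢0 k}}) (begin
    fromℕ (k !) * (fromℕ (suc k) * 1/ (suc k) !)
      ≈⟨ solve 3 (λ x y z → x :* (y :* z) := (y :* x) :* z) refl _ _ _ ⟩
    (fromℕ (suc k) * fromℕ (k !)) * 1/ (suc k) !  ≈⟨ *-congʳ (fromℕ-* (suc k) (k !)) ⟨
    fromℕ (suc k !) * 1/ (suc k) !                ≈⟨ k!*1/k! (suc k) ⟩
    1#                                            ≈⟨ k!*1/k! k ⟨
    fromℕ (k !) * 1/ k !                          ∎)
    where open SetoidReasoning setoid

  expTerm-suc : ∀ x k → fromℕ (suc k) * expTerm x (suc k) ≈ x * expTerm x k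
  expTerm-suc x k = trans
    (solve 4 (λ n x p f → n :* ((x :* p) :* f) := (x :* p) :* (n :* f)) refl (fromℕ (suc k)) x (x ^ k) (1/ (suc k) !))
    (trans (*-congˡ (1/suc! k)) (*-assoc x _ _))

  expTerm-cong : ∀ {x y} → x ≈ y → ∀ k → expTerm x k ≈ expTerm y k
  expTerm-cong x≈y k = *-congʳ (Exp.^-congˡ k x≈y)

  -- The binomial theorem without binomial coefficients: as coefficients of power series in t, both
  -- sides satisfy f′ = (x + y) f, which determines each coefficient from the previous one.
  expTerm-+ : ∀ x y K → antidiagonal (λ k l → expTerm x k * expTerm y l) K ≈ expTerm (x + y) K
  expTerm-+ x y zero = trans (*-congˡ (trans (*-congˡ 1/0!≈1) (*-identityʳ _))) (*-identityʳ _)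
    where
    1/0!≈1 : 1/ 0 ! ≈ 1#
    1/0!≈1 = trans (sym (trans (*-congʳ (+-identityʳ 1#)) (*-identityˡ _))) (k!*1/k! 0)
  expTerm-+ x y (suc K) = *-cancelˡ-≈ (fromℕ-pos (suc K)) (begin
    fromℕ (suc K) * antidiagonal (λ k l → expTerm x k * expTerm y l) (suc K)
      ≈⟨ antidiagonal-Δ (λ k l → expTerm x k * expTerm y l) K ⟩
    antidiagonal (λ k l → fromℕ (suc k) * (expTerm x (suc k) * expTerm y l)) K +
    antidiagonal (λ k l → fromℕ (suc l) * (expTerm x k * expTerm y (suc l))) K
      ≈⟨ antidiagonal-+ _ _ K ⟨
    antidiagonal (λ k l → fromℕ (suc k) * (expTerm x (suc k) * expTerm y l) +
                          fromℕ (suc l) * (expTerm x k * expTerm y (suc l))) K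
      ≈⟨ antidiagonal-cong step K ⟩
    antidiagonal (λ k l → (x + y) * (expTerm x k * expTerm y l)) K
      ≈⟨ antidiagonal-* (λ _ → x + y) _ K ⟩
    (x + y) * antidiagonal (λ k l → expTerm x k * expTerm y l) K
      ≈⟨ *-congˡ (expTerm-+ x y K) ⟩
    (x + y) * expTerm (x + y) K
      ≈⟨ expTerm-suc (x + y) K ⟨
    fromℕ (suc K) * expTerm (x + y) (suc K) ∎)
    where
    open SetoidReasoning setoid
    step : ∀ k l → fromℕ (suc k) * (expTerm x (suc k) * expTerm y l) +
                   fromℕ (suc l) * (expTerm x k * expTerm y (suc l))
                 ≈ (x + y) * (expTerm x k * expTerm y l)
    step k l = begin
      fromℕ (suc k) * (expTerm x (suc k) * expTerm y l) + fromℕ (suc l) * (expTerm x k * expTerm y (suc l))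
        ≈⟨ solve 6 (λ m n a a′ b b′ → m :* (a′ :* b) :+ n :* (a :* b′) := (m :* a′) :* b :+ a :* (n :* b′)) refl
             (fromℕ (suc k)) (fromℕ (suc l)) (expTerm x k) (expTerm x (suc k)) (expTerm y l) (expTerm y (suc l)) ⟩
      (fromℕ (suc k) * expTerm x (suc k)) * expTerm y l + expTerm x k * (fromℕ (suc l) * expTerm y (suc l))
        ≈⟨ +-cong (*-congʳ (expTerm-suc x k)) (*-congˡ (expTerm-suc y l)) ⟩
      (x * expTerm x k) * expTerm y l + expTerm x k * (y * expTerm y l)
        ≈⟨ solve 4 (λ x y a b → (x :* a) :* b :+ a :* (y :* b) := (x :+ y) :* (a :* b)) refl x y (expTerm x k) (expTerm y l) ⟩
      (x + y) * (expTerm x k * expTerm y l) ∎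

  ^-nonneg : ∀ {x} → 0# ≤ x → ∀ k → 0# ≤ x ^ k
  ^-nonneg 0≤x zero    = 0≤1
  ^-nonneg 0≤x (suc k) = *-nonneg 0≤x (^-nonneg 0≤x k)

  expTerm-nonneg : ∀ {x} → 0# ≤ x → ∀ k → 0# ≤ expTerm x k
  expTerm-nonneg 0≤x k = *-nonneg (^-nonneg 0≤x k) (<⇒≤ (1/k!-pos k))

  ∣^∣≤ : ∀ {x b} → ∣ x ∣ ≤ b → ∀ k → ∣ x ^ k ∣ ≤ b ^ k
  ∣^∣≤ ∣x∣≤b zero    = ≤-reflexive (0≤x⇒∣x∣≈x 0≤1)
  ∣^∣≤ ∣x∣≤b (suc k) = ∣x*y∣≤ ∣x∣≤b (∣^∣≤ ∣x∣≤b k)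

  ∣expTerm∣≤ : ∀ {x b} → ∣ x ∣ ≤ b → ∀ k → ∣ expTerm x k ∣ ≤ expTerm b k
  ∣expTerm∣≤ ∣x∣≤b k = ∣x*y∣≤ (∣^∣≤ ∣x∣≤b k) (≤-reflexive (0≤x⇒∣x∣≈x (<⇒≤ (1/k!-pos k))))

  -- Bernoulli's inequality 1 + k ≤ 2ᵏ, in the form that meets the Archimedean bound in `½^⟶0`.
  ½^k*[1+k]≤1 : ∀ k → ½ ^ k * fromℕ (suc k) ≤ 1#
  ½^k*[1+k]≤1 zero    = ≤-reflexive (trans (*-identityˡ _) (+-identityʳ _))
  ½^k*[1+k]≤1 (suc k) = begin
    (½ * ½ ^ k) * fromℕ (suc (suc k))
      ≤⟨ *-monoʳ-≤ (*-nonneg (<⇒≤ 0<½) (^-nonneg (<⇒≤ 0<½) k)) (+-monoˡ-≤ _ (x≤x+y (fromℕ-nonneg k))) ⟩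
    (½ * ½ ^ k) * (fromℕ (suc k) + fromℕ (suc k))
      ≈⟨ solve 3 (λ h p n → (h :* p) :* (n :+ n) := (h :+ h) :* (p :* n)) refl ½ (½ ^ k) (fromℕ (suc k)) ⟩
    (½ + ½) * (½ ^ k * fromℕ (suc k))  ≈⟨ trans (*-congʳ ½+½≈1) (*-identityˡ _) ⟩
    ½ ^ k * fromℕ (suc k)              ≤⟨ ½^k*[1+k]≤1 k ⟩
    1#                                 ∎
    where open ≤-Reasoning

  ½^⟶0 : (½ ^_) ⟶ 0#
  ½^⟶0 = ⟶-intro λ ε 0<ε → let N , ε⁻¹<N = archimedean (ε ⁻¹[ 0<ε ]) in N , λ k N≤k → begin
    ∣ ½ ^ k - 0# ∣   ≈⟨ ∣∣-cong (solve 1 (λ x → x :- con (0 , 0) := x) refl (½ ^ k)) ⟩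
    ∣ ½ ^ k ∣        ≈⟨ 0≤x⇒∣x∣≈x (^-nonneg (<⇒≤ 0<½) k) ⟩
    ½ ^ k            ≈⟨ *-identityʳ _ ⟨
    ½ ^ k * 1#       ≈⟨ *-congˡ (*-⁻¹ ε 0<ε) ⟨
    ½ ^ k * (ε * ε ⁻¹[ 0<ε ])
      ≤⟨ *-monoʳ-≤ (^-nonneg (<⇒≤ 0<½) k) (*-monoʳ-≤ (<⇒≤ 0<ε)
           (≤-trans (<⇒≤ ε⁻¹<N) (fromℕ-mono-≤ (ℕ.m≤n⇒m≤1+n N≤k)))) ⟩
    ½ ^ k * (ε * fromℕ (suc k))
      ≈⟨ solve 3 (λ p e n → p :* (e :* n) := e :* (p :* n)) refl (½ ^ k) ε (fromℕ (suc k)) ⟩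
    ε * (½ ^ k * fromℕ (suc k))  ≤⟨ *-monoʳ-≤ (<⇒≤ 0<ε) (½^k*[1+k]≤1 k) ⟩
    ε * 1#                       ≈⟨ *-identityʳ ε ⟩
    ε                            ∎
    where open ≤-Reasoning

  -- Once k + 1 ≥ a, raising k multiplies the left side by a and the right side by k + 1; before
  -- that the power is at most aᵃ anyway.
  a^k≤a^a*k! : ∀ a .{{_ : ℕ.NonZero a}} k → a ℕ.^ k ℕ.≤ a ℕ.^ a ℕ.* k !
  a^k≤a^a*k! a zero = ℕ.≤-trans (ℕ.m^n>0 a a) (ℕ.≤-reflexive (≡.sym (ℕ.*-identityʳ _)))
  a^k≤a^a*k! a (suc k) with ℕ.≤-total a (suc k)
  ... | inj₁ a≤1+k = begin
    a ℕ.* a ℕ.^ k                     ≤⟨ ℕ.*-mono-≤ a≤1+k (a^k≤a^a*k! a k) ⟩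
    suc k ℕ.* (a ℕ.^ a ℕ.* k !)       ≡⟨ ℕ.*-assoc (suc k) (a ℕ.^ a) (k !) ⟨
    suc k ℕ.* a ℕ.^ a ℕ.* k !         ≡⟨ ≡.cong (ℕ._* k !) (ℕ.*-comm (suc k) (a ℕ.^ a)) ⟩
    a ℕ.^ a ℕ.* suc k ℕ.* k !         ≡⟨ ℕ.*-assoc (a ℕ.^ a) (suc k) (k !) ⟩
    a ℕ.^ a ℕ.* (suc k) !             ∎
    where open ℕ.≤-Reasoning
  ... | inj₂ 1+k≤a = ℕ.≤-trans (ℕ.^-monoʳ-≤ a 1+k≤a) (ℕ.m≤m*n (a ℕ.^ a) (suc k !) {{ℕ._!≢0 (suc k)}})

  fromℕ-^ : ∀ a k → fromℕ (a ℕ.^ k) ≈ fromℕ a ^ k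
  fromℕ-^ a zero    = +-identityʳ 1#
  fromℕ-^ a (suc k) = trans (fromℕ-* a (a ℕ.^ k)) (*-congˡ (fromℕ-^ a k))

  expTerm-geometric : ∀ {x} a .{{_ : ℕ.NonZero a}} → ∣ x ∣ ≤ ½ * fromℕ a →
    ∀ k → ∣ expTerm x k ∣ ≤ fromℕ (a ℕ.^ a) * ½ ^ k
  expTerm-geometric {x} a ∣x∣≤a/2 k = begin
    ∣ expTerm x k ∣                    ≤⟨ ∣expTerm∣≤ ∣x∣≤a/2 k ⟩
    (½ * fromℕ a) ^ k * 1/ k !         ≈⟨ *-congʳ (CExp.^-distrib-* ½ (fromℕ a) k) ⟩
    (½ ^ k * fromℕ a ^ k) * 1/ k !     ≈⟨ *-congʳ (*-congˡ (fromℕ-^ a k)) ⟨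
    (½ ^ k * fromℕ (a ℕ.^ k)) * 1/ k !
      ≤⟨ *-monoˡ-≤ (<⇒≤ (1/k!-pos k)) (*-monoʳ-≤ (^-nonneg (<⇒≤ 0<½) k) (fromℕ-mono-≤ (a^k≤a^a*k! a k))) ⟩
    (½ ^ k * fromℕ (a ℕ.^ a ℕ.* k !)) * 1/ k !  ≈⟨ *-congʳ (*-congˡ (fromℕ-* (a ℕ.^ a) (k !))) ⟩
    (½ ^ k * (fromℕ (a ℕ.^ a) * fromℕ (k !))) * 1/ k !
      ≈⟨ solve 4 (λ p c f i → (p :* (c :* f)) :* i := (c :* p) :* (f :* i)) refl _ _ _ _ ⟩
    (fromℕ (a ℕ.^ a) * ½ ^ k) * (fromℕ (k !) * 1/ k !)  ≈⟨ *-congˡ (k!*1/k! k) ⟩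
    (fromℕ (a ℕ.^ a) * ½ ^ k) * 1#     ≈⟨ *-identityʳ _ ⟩
    fromℕ (a ℕ.^ a) * ½ ^ k            ∎
    where open ≤-Reasoning

  geometric-Cauchy : ∀ {a} C → (∀ k → ∣ a k ∣ ≤ C * ½ ^ k) → Cauchy (λ N → ∑< N a)
  -- Up to the constant 2C, this is the closed form of the partial sums of `C * ½ ^ k`.
  geometric-Cauchy {a} C bound = comparison (λ N → - (C + C) * ½ ^ N)
    (λ k → ≤-trans (bound k) (≤-reflexive (Δ k))) (⟶⇒Cauchy (⟶-* (- (C + C)) ½^⟶0))
    where
    open SetoidReasoning setoid
    Δ : ∀ k → C * ½ ^ k ≈ - (C + C) * ½ ^ suc k - - (C + C) * ½ ^ k
    Δ k = begin
      C * ½ ^ k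
        ≈⟨ solve 2 (λ C p → C :* p := :- (C :* p) :+ (C :+ C) :* p) refl C (½ ^ k) ⟩
      - (C * ½ ^ k) + (C + C) * ½ ^ k
        ≈⟨ +-congʳ (-‿cong (*-congˡ (trans (*-congʳ ½+½≈1) (*-identityˡ _)))) ⟨
      - (C * ((½ + ½) * ½ ^ k)) + (C + C) * ½ ^ k
        ≈⟨ solve 3 (λ C h p → :- (C :* ((h :+ h) :* p)) :+ (C :+ C) :* p := :- (C :+ C) :* (h :* p) :- :- (C :+ C) :* p) refl C ½ (½ ^ k) ⟩
      - (C + C) * ½ ^ suc k - - (C + C) * ½ ^ k ∎

  abstract
    exp-Cauchy : ∀ x → Cauchy (λ N → ∑< N (expTerm x))
    exp-Cauchy x =
      -- Bounding 2x rather than x leaves the ratio ½ that `expTerm-geometric` requires.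
      let b , ∣x+x∣≤ = ∣ x + x ∣-bound
      in geometric-Cauchy _ (expTerm-geometric (suc b) (≤-respˡ-≈
           (∣∣-cong (trans (distribˡ ½ x x) (trans (+-cong (*-comm ½ x) (*-comm ½ x)) (halves x))))
           (∣x*y∣≤ (≤-reflexive (0≤x⇒∣x∣≈x (<⇒≤ 0<½))) ∣x+x∣≤)))

  exp-exists : ∀ x → ∃[ y ] IsExp x y
  exp-exists x = complete _ (exp-Cauchy x)

  exp-unique : ∀ {x y a b} → IsExp x a → IsExp y b → x ≈ y → a ≈ b
  exp-unique {x} {y} x⟶a y⟶b x≈y = ⟶-unique
    (⟶-cong (λ N → ∑<-cong N (expTerm-cong x≈y)) refl x⟶a) y⟶b

  ⟶-∣∣≤ : ∀ {s l m ε} N → s ⟶ l → (∀ k → N ℕ.≤ k → ∣ s k - m ∣ ≤ ε) → ∣ l - m ∣ ≤ ε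
  ⟶-∣∣≤ {s} {l} {m} N s⟶l near = ∣∣-least
    (⟶-≤ N (⟶-+ s⟶l (⟶-const {l = - m} (λ _ → refl))) (λ k N≤k → ≤-trans (x≤∣x∣ _) (near k N≤k)))
    (⟶-≤ N (⟶-neg (⟶-+ s⟶l (⟶-const {l = - m} (λ _ → refl)))) (λ k N≤k → ≤-trans (-x≤∣x∣ _) (near k N≤k)))

  -- With k rows fixed and the number of columns going to infinity, the rectangle tends to `b` times
  -- the k-th partial sum for `x`. Its distance from the triangle is at most that for the majorants
  -- X ≥ |x| and Y ≥ |y|, hence at most a block of the convergent series for X + Y.
  exp-+ : ∀ {x y a b} → IsExp x a → IsExp y b → IsExp (x + y) (a * b)
  exp-+ {x} {y} {a} {b} x⟶a y⟶b with ∣ x ∣-bound | ∣ y ∣-bound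
  ... | i , ∣x∣≤X | j , ∣y∣≤Y = ⟶-near near
    (⟶-cong (λ N → *-comm b _) (*-comm b a) (⟶-* b x⟶a))
    where
    X = fromℕ (suc i)
    Y = fromℕ (suc j)
    g h : ℕ → ℕ → Carrier
    g k l = expTerm x k * expTerm y l
    h k l = expTerm X k * expTerm Y l

    triangle-g : ∀ N → triangle g N ≈ ∑< N (expTerm (x + y))
    triangle-g N = ∑<-cong N (expTerm-+ x y)
    triangle-h : ∀ N → triangle h N ≈ ∑< N (expTerm (X + Y))
    triangle-h N = ∑<-cong N (expTerm-+ X Y)

    rectangle-g : ∀ N L → rectangle g N L ≈ ∑< N (expTerm x) * ∑< L (expTerm y)
    rectangle-g N L = trans
      (∑<-cong N (λ k → trans (∑<-* L (expTerm x k) (expTerm y)) (*-comm _ _)))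
      (trans (∑<-* N (∑< L (expTerm y)) (expTerm x)) (*-comm _ _))

    ∣gkl∣≤hkl : ∀ k l → ∣ g k l ∣ ≤ h k l
    ∣gkl∣≤hkl k l = ∣x*y∣≤ (∣expTerm∣≤ ∣x∣≤X k) (∣expTerm∣≤ ∣y∣≤Y l)

    0≤h : ∀ k l → 0# ≤ h k l
    0≤h k l = ≤-trans (∣∣-nonneg _) (∣gkl∣≤hkl k l)

    near : ∀ ε → 0# < ε → ∃[ N ] (∀ k → N ℕ.≤ k →
      ∣ ∑< k (expTerm (x + y)) - ∑< k (expTerm x) * b ∣ ≤ ε)
    near ε 0<ε = let N , close = exp-Cauchy (X + Y) ε 0<ε in N , λ k N≤k → ≤-respˡ-≈ (∣x-y∣≈∣y-x∣ _ _) (⟶-∣∣≤ k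
      (⟶-cong (λ L → refl) refl (⟶-* (∑< k (expTerm x)) y⟶b))
      (λ L k≤L → begin
        ∣ ∑< k (expTerm x) * ∑< L (expTerm y) - ∑< k (expTerm (x + y)) ∣
          ≈⟨ ∣∣-cong (+-cong (rectangle-g k L) (-‿cong (triangle-g k))) ⟨
        ∣ rectangle g k L - triangle g k ∣
          ≤⟨ ∣rectangle-triangle∣≤ k≤L ∣gkl∣≤hkl ⟩
        rectangle h k L - triangle h k
          ≤⟨ +-monoˡ-≤ _ (rectangle≤triangle k L 0≤h) ⟩
        triangle h (k ℕ.+ L) - triangle h k
          ≈⟨ +-cong (triangle-h (k ℕ.+ L)) (-‿cong (triangle-h k)) ⟩
        ∑< (k ℕ.+ L) (expTerm (X + Y)) - ∑< k (expTerm (X + Y))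
          ≤⟨ x≤∣x∣ _ ⟩
        ∣ ∑< (k ℕ.+ L) (expTerm (X + Y)) - ∑< k (expTerm (X + Y)) ∣
          <⟨ close (k ℕ.+ L) k (ℕ.≤-trans N≤k (ℕ.m≤m+n k L)) N≤k ⟩
        ε ∎))
      where open ≤-Reasoning

  -- The alternating terms at a negative argument do not show the sign, but the value is the square
  -- of the exponential of x/2.
  exp-nonneg : ∀ {x a} → IsExp x a → 0# ≤ a
  exp-nonneg {x} x⟶a = let r , ½x⟶r = exp-exists (x * ½) in
    ≤-respʳ-≈ (exp-unique (exp-+ ½x⟶r ½x⟶r) x⟶a (halves x)) (square-nonneg r)

  exp-0 : IsExp 0# 1#
  exp-0 = ⟶-intro λ ε 0<ε → 1 , λ { (suc N) _ → ≤-trans (≤-reflexive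
      (trans (0≤x⇒∣x∣≈x (≤-reflexive (sym (diff N)))) (diff N))) (<⇒≤ 0<ε) }
    where
    diff : ∀ N → ∑< (suc N) (expTerm 0#) - 1# ≈ 0#
    diff N = trans (+-congʳ (trans (+-cong
        (trans (*-congʳ (sym (+-identityʳ 1#))) (k!*1/k! 0))
        (trans (∑<-cong N {b = λ _ → 0#} (λ k → trans (*-congʳ (zeroˡ (0# ^ k))) (zeroˡ (1/ (suc k) !)))) (Sum.sum-replicate-zero N)))
        (+-identityʳ 1#))) (-‿inverseʳ 1#)

  exp-inverse : ∀ {x a b} → IsExp (- x) a → IsExp x b → a * b ≈ 1#
  exp-inverse {x} -x⟶a x⟶b = exp-unique (exp-+ -x⟶a x⟶b) exp-0 (-‿inverseˡ x)

  -- Finite sums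

  sum-cong : ∀ {n} {u v : Fin n → Carrier} → (∀ i → u i ≈ v i) → sum u ≈ sum v
  sum-cong {n} = Sum.sum-cong-≋ {n}

  sum-+ : ∀ {n} (u v : Fin n → Carrier) → ∑[ i < n ] (u i + v i) ≈ sum u + sum v
  sum-+ = Sum.∑-distrib-+

  sum-*ˡ : ∀ {n} x (u : Fin n → Carrier) → ∑[ i < n ] (x * u i) ≈ x * sum u
  sum-*ˡ x u = sym (Sum.*-distribˡ-sum x u)

  sum-*ʳ : ∀ {n} x (u : Fin n → Carrier) → ∑[ i < n ] (u i * x) ≈ sum u * x
  sum-*ʳ x u = sym (Sum.*-distribʳ-sum x u)

  sum-0 : ∀ n → ∑[ i < n ] 0# ≈ 0#
  sum-0 = Sum.sum-replicate-zero

  sum-swap : ∀ {m n} (u : Fin m → Fin n → Carrier) →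
    ∑[ i < m ] ∑[ j < n ] u i j ≈ ∑[ j < n ] ∑[ i < m ] u i j
  sum-swap = Sum.∑-comm

  sum-⟶ : ∀ {n} {u : ℕ → Fin n → Carrier} {v} → (∀ i → (λ N → u N i) ⟶ v i) → (λ N → sum (u N)) ⟶ sum v
  sum-⟶ {zero}  u⟶v = ⟶-const (λ _ → refl)
  sum-⟶ {suc n} u⟶v = ⟶-+ (u⟶v zero) (sum-⟶ (u⟶v ∘ suc))

  -- Integration over k-tuples

  -- The recursion of `𝔼` for weights of any total mass, so that intensities such as m p can be
  -- split without normalising the pieces.
  ∫ : ∀ {n} → (Fin n → Carrier) → ∀ k → (Vec (Fin n) k → Carrier) → Carrier
  ∫         μ zero    g = g []
  ∫ {n = n} μ (suc k) g = ∑[ i < n ] (μ i * ∫ μ k (λ xs → g (i ∷ xs)))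

  module _ {n : ℕ} where

    𝔼≈∫ : ∀ (p : Distribution n) k f → 𝔼 p k f ≈ ∫ (prob p) k f
    𝔼≈∫ p zero    f = refl
    𝔼≈∫ p (suc k) f = sum-cong (λ i → *-congˡ (𝔼≈∫ p k (λ xs → f (i ∷ xs))))

    ∫-cong : ∀ {μ ν : Fin n → Carrier} {k f g} → (∀ i → μ i ≈ ν i) → (∀ xs → f xs ≈ g xs) → ∫ μ k f ≈ ∫ ν k g
    ∫-cong {k = zero}  μ≈ν f≈g = f≈g []
    ∫-cong {k = suc k} μ≈ν f≈g = sum-cong (λ i → *-cong (μ≈ν i) (∫-cong {k = k} μ≈ν (λ xs → f≈g (i ∷ xs))))

    ∫-nonneg : ∀ {μ : Fin n → Carrier} {k f} → (∀ i → 0# ≤ μ i) → (∀ xs → 0# ≤ f xs) → 0# ≤ ∫ μ k f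
    ∫-nonneg {k = zero}  0≤μ 0≤f = 0≤f []
    ∫-nonneg {k = suc k} 0≤μ 0≤f = sum-nonneg _ (λ i → *-nonneg (0≤μ i) (∫-nonneg {k = k} 0≤μ (λ xs → 0≤f (i ∷ xs))))

    ∫-+ : ∀ (μ : Fin n → Carrier) k f g → ∫ μ k (λ xs → f xs + g xs) ≈ ∫ μ k f + ∫ μ k g
    ∫-+ μ zero    f g = refl
    ∫-+ μ (suc k) f g = trans
      (sum-cong (λ i → trans (*-congˡ (∫-+ μ k (λ xs → f (i ∷ xs)) (λ xs → g (i ∷ xs)))) (distribˡ _ _ _)))
      (sum-+ {n} _ _)

    ∫-* : ∀ (μ : Fin n → Carrier) k x f → ∫ μ k (λ xs → x * f xs) ≈ x * ∫ μ k f
    ∫-* μ zero    x f = refl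
    ∫-* μ (suc k) x f = trans
      (sum-cong (λ i → trans (*-congˡ (∫-* μ k x (λ xs → f (i ∷ xs))))
        (solve 3 (λ m x y → m :* (x :* y) := x :* (m :* y)) refl _ _ _)))
      (sum-*ˡ {n} x _)

    ∫-0 : ∀ (μ : Fin n → Carrier) k → ∫ μ k (λ _ → 0#) ≈ 0#
    ∫-0 μ zero    = refl
    ∫-0 μ (suc k) = trans (sum-cong (λ i → trans (*-congˡ (∫-0 μ k)) (zeroʳ (μ i)))) (sum-0 n)

    ∫-sum : ∀ (μ : Fin n → Carrier) k {m} (f : Fin m → Vec (Fin n) k → Carrier) →
      ∫ μ k (λ xs → ∑[ j < m ] f j xs) ≈ ∑[ j < m ] ∫ μ k (f j)
    ∫-sum μ k {zero}  f = ∫-0 μ k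
    ∫-sum μ k {suc m} f = trans (∫-+ μ k (f zero) (λ xs → ∑[ j < m ] f (suc j) xs)) (+-congˡ (∫-sum μ k (f ∘ suc)))

    ∫-linear : ∀ (μ : Fin n → Carrier) k {m} (x : Fin m → Carrier) (f : Fin m → Vec (Fin n) k → Carrier) →
      ∫ μ k (λ xs → ∑[ j < m ] (x j * f j xs)) ≈ ∑[ j < m ] (x j * ∫ μ k (f j))
    ∫-linear μ k x f = trans (∫-sum μ k (λ j xs → x j * f j xs)) (sum-cong (λ j → ∫-* μ k (x j) (f j)))

    ∫-scale : ∀ x (μ : Fin n → Carrier) k f → ∫ (λ i → x * μ i) k f ≈ x ^ k * ∫ μ k f
    ∫-scale x μ zero    f = sym (*-identityˡ _)
    ∫-scale x μ (suc k) f = trans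
      (sum-cong (λ i → trans (*-congˡ (∫-scale x μ k (λ xs → f (i ∷ xs))))
        (solve 4 (λ x m p y → (x :* m) :* (p :* y) := (x :* p) :* (m :* y)) refl _ _ _ _)))
      (sum-*ˡ {n} (x * x ^ k) _)

    ∫-⟶ : ∀ (μ : Fin n → Carrier) k {s : ℕ → Vec (Fin n) k → Carrier} {f} →
      (∀ xs → (λ N → s N xs) ⟶ f xs) → (λ N → ∫ μ k (s N)) ⟶ ∫ μ k f
    ∫-⟶ μ zero    s⟶f = s⟶f []
    ∫-⟶ μ (suc k) s⟶f = sum-⟶ (λ i → ⟶-* (μ i) (∫-⟶ μ k (λ xs → s⟶f (i ∷ xs))))

  -- Defined on samples of every length, so that fixing the first sample stays within the type;
  -- recursions on samples pass from `f` to `i ◂ f`.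
  Statistic : ℕ → Set c
  Statistic n = ∀ {k} → Vec (Fin n) k → Carrier

  infixr 6 _◂_

  _◂_ : ∀ {n} → Fin n → Statistic n → Statistic n
  (i ◂ f) xs = f (i ∷ xs)

  -- Poisson splitting

  module Mixture {R n : ℕ} (w : Fin R → Fin n → Carrier) (σ : Fin n → Carrier) where

    -- The sum of f over all interleavings of the sequence y₁ … yₖ, each yᵢ being
    -- replaced by a sample from w yᵢ, with l samples from σ.
    mix : ∀ {k} → Vec (Fin R) k → ℕ → Statistic n → Carrier
    mix []       zero    f = f []
    mix []       (suc l) f = ∑[ i < n ] (σ i * mix [] l (i ◂ f))
    mix (y ∷ ys) zero    f = ∑[ i < n ] (w y i * mix ys zero (i ◂ f))
    mix (y ∷ ys) (suc l) f = ∑[ i < n ] (w y i * mix ys (suc l) (i ◂ f))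
                           + ∑[ i < n ] (σ i * mix (y ∷ ys) l (i ◂ f))

    private
      sum-*-+ : ∀ (μ u v x : Fin n → Carrier) → (∀ i → u i + v i ≈ x i) →
        ∑[ i < n ] (μ i * u i) + ∑[ i < n ] (μ i * v i) ≈ ∑[ i < n ] (μ i * x i)
      sum-*-+ μ u v x u+v≈x = trans (sym (sum-+ {n} _ _))
        (sum-cong (λ i → trans (sym (distribˡ _ _ _)) (*-congˡ (u+v≈x i))))

    -- The sum enters as a third statistic up to `_≈_`, so that this applies directly to acceptance
    -- and rejection adding up to 1.
    mix-+ : ∀ {k} (ys : Vec (Fin R) k) l (f g h : Statistic n) →
      (∀ {k} (xs : Vec (Fin n) k) → f xs + g xs ≈ h xs) → mix ys l f + mix ys l g ≈ mix ys l h
    mix-+ []       zero    f g h eq = eq []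
    mix-+ []       (suc l) f g h eq =
      sum-*-+ _ _ _ _ (λ i → mix-+ [] l (i ◂ f) (i ◂ g) (i ◂ h) (λ xs → eq (i ∷ xs)))
    mix-+ (y ∷ ys) zero    f g h eq =
      sum-*-+ _ _ _ _ (λ i → mix-+ ys zero (i ◂ f) (i ◂ g) (i ◂ h) (λ xs → eq (i ∷ xs)))
    mix-+ (y ∷ ys) (suc l) f g h eq = trans (IntegerSolver.interchange _ _ _ _) (+-cong
      (sum-*-+ _ _ _ _ (λ i → mix-+ ys (suc l) (i ◂ f) (i ◂ g) (i ◂ h) (λ xs → eq (i ∷ xs))))
      (sum-*-+ _ _ _ _ (λ i → mix-+ (y ∷ ys) l (i ◂ f) (i ◂ g) (i ◂ h) (λ xs → eq (i ∷ xs)))))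

    mix-nonneg : (∀ y i → 0# ≤ w y i) → (∀ i → 0# ≤ σ i) →
      ∀ {k} (ys : Vec (Fin R) k) l (f : Statistic n) →
      (∀ {k} (xs : Vec (Fin n) k) → 0# ≤ f xs) → 0# ≤ mix ys l f
    mix-nonneg 0≤w 0≤σ = go
      where
      go : ∀ {k} (ys : Vec (Fin R) k) l (f : Statistic n) →
        (∀ {k} (xs : Vec (Fin n) k) → 0# ≤ f xs) → 0# ≤ mix ys l f
      go []       zero    f 0≤f = 0≤f []
      go []       (suc l) f 0≤f = sum-nonneg _ (λ i → *-nonneg (0≤σ i) (go [] l (i ◂ f) (λ xs → 0≤f (i ∷ xs))))
      go (y ∷ ys) zero    f 0≤f = sum-nonneg _ (λ i → *-nonneg (0≤w y i) (go ys zero (i ◂ f) (λ xs → 0≤f (i ∷ xs))))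
      go (y ∷ ys) (suc l) f 0≤f = +-nonneg
        (sum-nonneg _ (λ i → *-nonneg (0≤w y i) (go ys (suc l) (i ◂ f) (λ xs → 0≤f (i ∷ xs)))))
        (sum-nonneg _ (λ i → *-nonneg (0≤σ i) (go (y ∷ ys) l (i ◂ f) (λ xs → 0≤f (i ∷ xs)))))

    -- The binomial coefficient "k + l choose k", computed by the recursion of `mix`.
    interleavings : ℕ → ℕ → ℕ
    interleavings zero    l       = 1
    interleavings (suc k) zero    = 1
    interleavings (suc k) (suc l) = interleavings k (suc l) ℕ.+ interleavings (suc k) l

    interleavings-! : ∀ k l → interleavings k l ℕ.* (k ! ℕ.* l !) ≡ (k ℕ.+ l) !
    interleavings-! zero    l       = ≡.trans (ℕ.*-identityˡ _) (ℕ.*-identityˡ _)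
    interleavings-! (suc k) zero    =
      ≡.trans (ℕ.*-identityˡ _) (≡.trans (ℕ.*-identityʳ _) (≡.cong (λ j → suc j !) (≡.sym (ℕ.+-identityʳ k))))
    interleavings-! (suc k) (suc l) = begin
      (a ℕ.+ b) ℕ.* (suc k ! ℕ.* suc l !)
        ≡⟨ ℕ-solve a b (suc k) (k !) (suc l) (l !) ⟩
      suc k ℕ.* (a ℕ.* (k ! ℕ.* suc l !)) ℕ.+ suc l ℕ.* (b ℕ.* (suc k ! ℕ.* l !))
        ≡⟨ ≡.cong₂ (λ x y → suc k ℕ.* x ℕ.+ suc l ℕ.* y) (interleavings-! k (suc l)) (interleavings-! (suc k) l) ⟩
      suc k ℕ.* (k ℕ.+ suc l) ! ℕ.+ suc l ℕ.* (suc k ℕ.+ l) !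
        ≡⟨ ≡.cong (λ j → suc k ℕ.* (k ℕ.+ suc l) ! ℕ.+ suc l ℕ.* j !) (≡.sym (ℕ.+-suc k l)) ⟩
      suc k ℕ.* (k ℕ.+ suc l) ! ℕ.+ suc l ℕ.* (k ℕ.+ suc l) !
        ≡⟨ ℕ.*-distribʳ-+ ((k ℕ.+ suc l) !) (suc k) (suc l) ⟨
      (suc k ℕ.+ suc l) ! ∎
      where
      open ≡.≡-Reasoning
      a = interleavings k (suc l)
      b = interleavings (suc k) l
      ℕ-solve : ∀ a b k k! l l! → (a ℕ.+ b) ℕ.* ((k ℕ.* k!) ℕ.* (l ℕ.* l!)) ≡
        k ℕ.* (a ℕ.* (k! ℕ.* (l ℕ.* l!))) ℕ.+ l ℕ.* (b ℕ.* ((k ℕ.* k!) ℕ.* l!))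
      ℕ-solve = ℕ-solve-∀

    -- In each interleaving the samples from `w` contribute mass 1 and the samples from `σ`
    -- contribute mass `s` each.
    mix-1 : ∀ {s} → (∀ y → sum (w y) ≈ 1#) → sum σ ≈ s → ∀ {k} (ys : Vec (Fin R) k) l →
      mix ys l (λ _ → 1#) ≈ fromℕ (interleavings k l) * s ^ l
    mix-1 {s} ∑w≈1 ∑σ≈s = go
      where
      open SetoidReasoning setoid
      go : ∀ {k} (ys : Vec (Fin R) k) l → mix ys l (λ _ → 1#) ≈ fromℕ (interleavings k l) * s ^ l
      pull : ∀ {k} (ys : Vec (Fin R) k) l {μ : Fin n → Carrier} {x} → sum μ ≈ x →
        ∑[ i < n ] (μ i * mix ys l (λ _ → 1#)) ≈ x * (fromℕ (interleavings k l) * s ^ l)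
      pull ys l {μ} ∑μ≈x = trans (sum-*ʳ (mix ys l (λ _ → 1#)) μ) (*-cong ∑μ≈x (go ys l))
      go []       zero    = sym (trans (*-identityʳ _) (+-identityʳ 1#))
      go []       (suc l) = trans (pull [] l ∑σ≈s) (solve 3 (λ s i p → s :* (i :* p) := i :* (s :* p)) refl _ _ _)
      -- The tail is split because `interleavings k zero` computes only for `k` in constructor form.
      go (y ∷ []) zero    = trans (pull [] zero (∑w≈1 y)) (*-identityˡ _)
      go (y ∷ ys@(_ ∷ _)) zero    = trans (pull ys zero (∑w≈1 y)) (*-identityˡ _)
      go {suc k} (y ∷ ys) (suc l) = begin
        ∑[ i < n ] (w y i * mix ys (suc l) (λ _ → 1#)) + ∑[ i < n ] (σ i * mix (y ∷ ys) l (λ _ → 1#))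
          ≈⟨ +-cong (pull ys (suc l) (∑w≈1 y)) (pull (y ∷ ys) l ∑σ≈s) ⟩
        1# * (fromℕ (interleavings k (suc l)) * (s * s ^ l)) + s * (fromℕ (interleavings (suc k) l) * s ^ l)
          ≈⟨ solve 4 (λ a b s p → con (1 , 0) :* (a :* (s :* p)) :+ s :* (b :* p) := (a :+ b) :* (s :* p)) refl _ _ _ _ ⟩
        (fromℕ (interleavings k (suc l)) + fromℕ (interleavings (suc k) l)) * (s * s ^ l)
          ≈⟨ *-congʳ (fromℕ-+ (interleavings k (suc l)) (interleavings (suc k) l)) ⟨
        fromℕ (interleavings (suc k) (suc l)) * s ^ suc l ∎

    -- A noncommutative binomial theorem: the product weight is multiplied out and its terms are
    -- grouped by the number of coordinates taken from `σ`. As `f` may depend on the order of the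
    -- samples, `mix` takes the place of a binomial coefficient.
    expand : ∀ (π : Fin R → Carrier) K (f : Statistic n) →
      ∫ (λ i → ∑[ y < R ] (π y * w y i) + σ i) K f ≈ antidiagonal (λ k l → ∫ π k (λ ys → mix ys l f)) K
    expand π zero    f = refl
    expand π (suc K) f = begin
      ∑[ i < n ] ((μ i + σ i) * ∫ ρ K (i ◂ f))
        ≈⟨ sum-cong (λ i → *-congˡ (expand π K (i ◂ f))) ⟩
      ∑[ i < n ] ((μ i + σ i) * antidiagonal (G (i ◂ f)) K)
        ≈⟨ trans (sum-cong (λ i → distribʳ (antidiagonal (G (i ◂ f)) K) (μ i) (σ i)))
             (sum-+ (λ i → μ i * antidiagonal (G (i ◂ f)) K) (λ i → σ i * antidiagonal (G (i ◂ f)) K)) ⟩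
      ∑[ i < n ] (μ i * antidiagonal (G (i ◂ f)) K) + ∑[ i < n ] (σ i * antidiagonal (G (i ◂ f)) K)
        ≈⟨ +-cong (antidiagonal-linear μ (λ i → G (i ◂ f)) K) (antidiagonal-linear σ (λ i → G (i ◂ f)) K) ⟨
      antidiagonal (λ k l → A (suc k) l) K + antidiagonal (λ k l → B k (suc l)) K
        -- Row 0 of `A` and column 0 of `B` vanish, so both sums extend to the whole antidiagonal
        -- `suc K`.
        ≈⟨ +-cong (+-identityˡ _) (+-identityʳ _) ⟨
      antidiagonal A (suc K) + (antidiagonal (λ k l → B k (suc l)) K + B (suc K) 0)
        ≈⟨ +-congˡ (antidiagonal-snoc B K) ⟨
      antidiagonal A (suc K) + antidiagonal B (suc K)
        ≈⟨ antidiagonal-+ A B (suc K) ⟨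
      antidiagonal (λ k l → A k l + B k l) (suc K)
        ≈⟨ +-cong (+-identityˡ _) (antidiagonal-cong (λ k l → sym (pascal k l)) K) ⟩
      antidiagonal (G f) (suc K) ∎
      where
      open SetoidReasoning setoid
      μ ρ : Fin n → Carrier
      μ i = ∑[ y < R ] (π y * w y i)
      ρ i = μ i + σ i
      G : Statistic n → ℕ → ℕ → Carrier
      G f k l = ∫ π k (λ ys → mix ys l f)
      -- A and B collect the interleavings that start with a sample from w,
      -- respectively from σ.
      A B : ℕ → ℕ → Carrier
      A zero    l       = 0#
      A (suc k) l       = ∑[ i < n ] (μ i * G (i ◂ f) k l)
      B k       zero    = 0#
      B k       (suc l) = ∑[ i < n ] (σ i * G (i ◂ f) k l)

      antidiagonal-linear : ∀ (x : Fin n → Carrier) (g : Fin n → ℕ → ℕ → Carrier) K →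
        antidiagonal (λ k l → ∑[ i < n ] (x i * g i k l)) K ≈ ∑[ i < n ] (x i * antidiagonal (g i) K)
      antidiagonal-linear x g zero    = refl
      antidiagonal-linear x g (suc K) = trans (+-congˡ (antidiagonal-linear x (λ i → g i ∘ suc) K))
        (trans (sym (sum-+ (λ i → x i * g i 0 (suc K)) (λ i → x i * antidiagonal (g i ∘ suc) K)))
          (sum-cong (λ i → sym (distribˡ (x i) (g i 0 (suc K)) (antidiagonal (g i ∘ suc) K)))))

      first-w : ∀ k l → ∑[ y < R ] (π y * ∫ π k (λ ys → ∑[ i < n ] (w y i * mix ys l (i ◂ f)))) ≈ A (suc k) l
      first-w k l = begin
        ∑[ y < R ] (π y * ∫ π k (λ ys → ∑[ i < n ] (w y i * mix ys l (i ◂ f))))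
          ≈⟨ sum-cong (λ y → *-congˡ (∫-linear π k (w y) (λ i ys → mix ys l (i ◂ f)))) ⟩
        ∑[ y < R ] (π y * ∑[ i < n ] (w y i * G (i ◂ f) k l))
          ≈⟨ sum-cong (λ y → trans (sym (sum-*ˡ (π y) (λ i → w y i * G (i ◂ f) k l)))
               (sum-cong (λ i → sym (*-assoc (π y) (w y i) (G (i ◂ f) k l))))) ⟩
        ∑[ y < R ] ∑[ i < n ] (π y * w y i * G (i ◂ f) k l)
          ≈⟨ sum-swap (λ y i → π y * w y i * G (i ◂ f) k l) ⟩
        ∑[ i < n ] ∑[ y < R ] (π y * w y i * G (i ◂ f) k l)
          ≈⟨ sum-cong (λ i → sum-*ʳ (G (i ◂ f) k l) (λ y → π y * w y i)) ⟩
        ∑[ i < n ] (μ i * G (i ◂ f) k l) ∎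

      pascal : ∀ k l → G f (suc k) l ≈ A (suc k) l + B (suc k) l
      pascal k zero    = trans (first-w k zero) (sym (+-identityʳ _))
      pascal k (suc l) = begin
        ∑[ y < R ] (π y * ∫ π k (λ ys → ∑[ i < n ] (w y i * mix ys (suc l) (i ◂ f))
                                      + ∑[ i < n ] (σ i * mix (y ∷ ys) l (i ◂ f))))
          ≈⟨ ∫-+ π (suc k) (λ { (y ∷ ys) → ∑[ i < n ] (w y i * mix ys (suc l) (i ◂ f)) })
                           (λ ys → ∑[ i < n ] (σ i * mix ys l (i ◂ f))) ⟩
        ∑[ y < R ] (π y * ∫ π k (λ ys → ∑[ i < n ] (w y i * mix ys (suc l) (i ◂ f))))
          + ∫ π (suc k) (λ ys → ∑[ i < n ] (σ i * mix ys l (i ◂ f)))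
          ≈⟨ +-cong (first-w k (suc l)) (∫-linear π (suc k) σ (λ i ys → mix ys l (i ◂ f))) ⟩
        A (suc k) (suc l) + B (suc k) (suc l) ∎

  -- Averaging a statistic over Poisson noise

  module Poissonize {R n : ℕ} (w : Fin R → Fin n → Carrier) (σ : Fin n → Carrier)
    (0≤w : ∀ y i → 0# ≤ w y i) (∑w≈1 : ∀ y → sum (w y) ≈ 1#) (0≤σ : ∀ i → 0# ≤ σ i) where

    open Mixture w σ

    s e⁻ˢ : Carrier
    s   = sum σ
    e⁻ˢ = proj₁ (exp-exists (- s))

    -- k! / (k + l)! = (1 / l!) / (number of interleavings), so that averageTerm
    -- averages over all interleavings of ys with l ∼ Poi(s) samples from σ / s.
    weight : ℕ → ℕ → Carrier
    weight k l = fromℕ (k !) * 1/ (k ℕ.+ l) !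

    weight-nonneg : ∀ k l → 0# ≤ weight k l
    weight-nonneg k l = *-nonneg (fromℕ-nonneg (k !)) (<⇒≤ (1/k!-pos (k ℕ.+ l)))

    weight-interleavings : ∀ k l → weight k l * fromℕ (interleavings k l) ≈ 1/ l !
    weight-interleavings k l = *-cancelˡ-≈ (fromℕ-pos (l !) {{ℕ._!≢0 l}}) (begin
      fromℕ (l !) * (weight k l * fromℕ (interleavings k l))
        ≈⟨ solve 4 (λ l! k! j x → l! :* ((k! :* j) :* x) := (x :* (k! :* l!)) :* j) refl _ _ _ _ ⟩
      (fromℕ (interleavings k l) * (fromℕ (k !) * fromℕ (l !))) * 1/ (k ℕ.+ l) !
        ≈⟨ *-congʳ (trans (fromℕ-* (interleavings k l) (k ! ℕ.* l !)) (*-congˡ (fromℕ-* (k !) (l !)))) ⟨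
      fromℕ (interleavings k l ℕ.* (k ! ℕ.* l !)) * 1/ (k ℕ.+ l) !
        ≡⟨ ≡.cong (λ j → fromℕ j * 1/ (k ℕ.+ l) !) (interleavings-! k l) ⟩
      fromℕ ((k ℕ.+ l) !) * 1/ (k ℕ.+ l) !  ≈⟨ k!*1/k! (k ℕ.+ l) ⟩
      1#                                    ≈⟨ k!*1/k! l ⟨
      fromℕ (l !) * 1/ l !                  ∎)
      where open SetoidReasoning setoid

    averageTerm : Statistic n → ∀ {k} → Vec (Fin R) k → ℕ → Carrier
    averageTerm f {k} ys l = e⁻ˢ * (weight k l * mix ys l f)

    averageTerm-+ : ∀ (f g h : Statistic n) → (∀ {k} (xs : Vec (Fin n) k) → f xs + g xs ≈ h xs) →
      ∀ {k} (ys : Vec (Fin R) k) l → averageTerm f ys l + averageTerm g ys l ≈ averageTerm h ys l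
    averageTerm-+ f g h f+g≈h ys l = trans (sym (distribˡ _ _ _)) (*-congˡ
      (trans (sym (distribˡ _ _ _)) (*-congˡ (mix-+ ys l f g h f+g≈h))))

    averageTerm-1 : ∀ {k} (ys : Vec (Fin R) k) l → averageTerm (λ _ → 1#) ys l ≈ e⁻ˢ * expTerm s l
    averageTerm-1 {k} ys l = *-congˡ (trans (*-congˡ (mix-1 ∑w≈1 refl ys l))
      (trans (sym (*-assoc _ _ _)) (trans (*-congʳ (weight-interleavings k l)) (*-comm _ _))))

    -- Averaging has total weight e⁻ˢ Σ sˡ / l! = 1. This gives the summable majorant for
    -- `average-exists`, the bound `average≤1`, and later the agreement of both verdicts of the new
    -- tester.
    averageTerm-1-sum : ∀ {k} (ys : Vec (Fin R) k) → averageTerm (λ _ → 1#) ys sumsTo 1#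
    averageTerm-1-sum ys = let e , s⟶e = exp-exists s in ⟶-cong
      (λ L → sym (trans (∑<-cong L (averageTerm-1 ys)) (∑<-* L e⁻ˢ (expTerm s))))
      (exp-inverse (proj₂ (exp-exists (- s))) s⟶e)
      (⟶-* e⁻ˢ s⟶e)

    averageTerm-nonneg : ∀ (f : Statistic n) → (∀ {k} (xs : Vec (Fin n) k) → 0# ≤ f xs) →
      ∀ {k} (ys : Vec (Fin R) k) l → 0# ≤ averageTerm f ys l
    averageTerm-nonneg f 0≤f {k} ys l = *-nonneg (exp-nonneg (proj₂ (exp-exists (- s))))
      (*-nonneg (weight-nonneg k l) (mix-nonneg 0≤w 0≤σ ys l f 0≤f))

    module Average (f : Statistic n)
      (0≤f : ∀ {k} (xs : Vec (Fin n) k) → 0# ≤ f xs)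
      (f≤1 : ∀ {k} (xs : Vec (Fin n) k) → f xs ≤ 1#) where

      -- The gap is the average term of the nonnegative statistic 1 - f.
      averageTerm≤ : ∀ {k} (ys : Vec (Fin R) k) l → averageTerm f ys l ≤ averageTerm (λ _ → 1#) ys l
      averageTerm≤ ys l = ≤-by
        (averageTerm-nonneg (λ xs → 1# - f xs) (λ xs → x≤y⇒0≤y-x (f≤1 xs)) ys l)
        (sym (averageTerm-+ f (λ xs → 1# - f xs) (λ _ → 1#)
          (λ xs → solve 2 (λ x y → x :+ (y :- x) := y) refl (f xs) 1#) ys l))

      average-exists : ∀ {k} (ys : Vec (Fin R) k) → ∃[ a ] averageTerm f ys sumsTo a
      average-exists ys = complete _ (dominated
        (λ l → ≤-trans (≤-reflexive (0≤x⇒∣x∣≈x (averageTerm-nonneg f 0≤f ys l))) (averageTerm≤ ys l))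
        (⟶⇒Cauchy (averageTerm-1-sum ys)))

      average : Statistic R
      average ys = proj₁ (average-exists ys)

      average-sum : ∀ {k} (ys : Vec (Fin R) k) → averageTerm f ys sumsTo average ys
      average-sum ys = proj₂ (average-exists ys)

      average-nonneg : ∀ {k} (ys : Vec (Fin R) k) → 0# ≤ average ys
      average-nonneg ys = partial≤total (averageTerm-nonneg f 0≤f ys) (average-sum ys) 0

      average≤1 : ∀ {k} (ys : Vec (Fin R) k) → average ys ≤ 1#
      average≤1 ys = ⟶-monotone-≤ (average-sum ys) (averageTerm-1-sum ys) (λ L → ∑<-mono-≤ L (averageTerm≤ ys))

      module _ (p : Distribution n) (p′ : Distribution R) {m m′ : Carrier} (0≤m′ : 0# ≤ m′)
        (mp≈ : ∀ i → m * prob p i ≈ ∑[ y < R ] (m′ * prob p′ y * w y i) + σ i) where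

        -- Compares total masses in `mp≈`; it makes the Poisson normalisations match, e⁻ᵐ = e⁻ᵐ′
        -- e⁻ˢ.
        m≈m′+s : m ≈ m′ + s
        m≈m′+s = begin
          m                                                        ≈⟨ *-identityʳ m ⟨
          m * 1#                                                   ≈⟨ *-congˡ (total p) ⟨
          m * sum (prob p)                                         ≈⟨ sum-*ˡ m (prob p) ⟨
          ∑[ i < n ] (m * prob p i)                                ≈⟨ sum-cong mp≈ ⟩
          ∑[ i < n ] (∑[ y < R ] (m′ * prob p′ y * w y i) + σ i)   ≈⟨ sum-+ {n} _ σ ⟩
          ∑[ i < n ] ∑[ y < R ] (m′ * prob p′ y * w y i) + s       ≈⟨ +-congʳ (sum-swap (λ i y → m′ * prob p′ y * w y i)) ⟩
          ∑[ y < R ] ∑[ i < n ] (m′ * prob p′ y * w y i) + s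
            ≈⟨ +-congʳ (sum-cong (λ y → trans (sum-*ˡ _ (w y)) (trans (*-congˡ (∑w≈1 y)) (*-identityʳ _)))) ⟩
          ∑[ y < R ] (m′ * prob p′ y) + s                          ≈⟨ +-congʳ (sum-*ˡ m′ (prob p′)) ⟩
          m′ * sum (prob p′) + s                                   ≈⟨ +-congʳ (trans (*-congˡ (total p′)) (*-identityʳ m′)) ⟩
          m′ + s                                                   ∎
          where open SetoidReasoning setoid

        -- The entry `g k l` is the contribution of k samples from `p′` and l noise samples. Its
        -- rows give the series of the averaged statistic under `p′`, and its antidiagonals K = k +
        -- l the given convergent series under `p`.
        poissonize : ∀ {a} → IsPoissonExpectation m (λ k → 𝔼 p k f) a →
          IsPoissonExpectation m′ (λ k → 𝔼 p′ k average) a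
        poissonize {a} (e⁻ᵐ , -m⟶e⁻ᵐ , sums) = e⁻ᵐ′ , -m′⟶e⁻ᵐ′ , sum-by-rows g-nonneg rows
          (⟶-cong (λ K → ∑<-cong K diagonals) refl sums)
          where
          open SetoidReasoning setoid
          e⁻ᵐ′ = proj₁ (exp-exists (- m′))
          -m′⟶e⁻ᵐ′ = proj₂ (exp-exists (- m′))
          e⁻ᵐ≈ : e⁻ᵐ ≈ e⁻ᵐ′ * e⁻ˢ
          e⁻ᵐ≈ = exp-unique -m⟶e⁻ᵐ (exp-+ -m′⟶e⁻ᵐ′ (proj₂ (exp-exists (- s))))
            (trans (-‿cong m≈m′+s) (solve 2 (λ x y → :- (x :+ y) := :- x :+ :- y) refl m′ s))

          g : ℕ → ℕ → Carrier
          g k l = e⁻ᵐ′ * expTerm m′ k * ∫ (prob p′) k (λ ys → averageTerm f ys l)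

          π : Fin R → Carrier
          π y = m′ * prob p′ y

          -- The k! in `weight` cancels the 1/k! of the Poisson term, leaving a prefactor that
          -- depends on k + l only and so leaves the antidiagonal sum.
          g≈ : ∀ k l → g k l ≈ (e⁻ᵐ * 1/ (k ℕ.+ l) !) * ∫ π k (λ ys → mix ys l f)
          g≈ k l = begin
            e⁻ᵐ′ * expTerm m′ k * ∫ (prob p′) k (λ ys → averageTerm f ys l)
              ≈⟨ *-congˡ (trans (∫-* (prob p′) k e⁻ˢ (λ ys → weight k l * mix ys l f))
                   (*-congˡ (∫-* (prob p′) k (weight k l) (λ ys → mix ys l f)))) ⟩
            e⁻ᵐ′ * (m′ ^ k * 1/ k !) * (e⁻ˢ * ((fromℕ (k !) * 1/ (k ℕ.+ l) !) * I))
              ≈⟨ solve 7 (λ a b p i k! j I → a :* (p :* i) :* (b :* ((k! :* j) :* I)) :=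
                   ((a :* b) :* j) :* (p :* I) :* (k! :* i)) refl e⁻ᵐ′ e⁻ˢ (m′ ^ k) (1/ k !) (fromℕ (k !)) (1/ (k ℕ.+ l) !) I ⟩
            ((e⁻ᵐ′ * e⁻ˢ) * 1/ (k ℕ.+ l) !) * (m′ ^ k * I) * (fromℕ (k !) * 1/ k !)
              ≈⟨ trans (*-congˡ (k!*1/k! k)) (*-identityʳ _) ⟩
            ((e⁻ᵐ′ * e⁻ˢ) * 1/ (k ℕ.+ l) !) * (m′ ^ k * I)
              ≈⟨ *-cong (*-congʳ e⁻ᵐ≈) (∫-scale m′ (prob p′) k (λ ys → mix ys l f)) ⟨
            (e⁻ᵐ * 1/ (k ℕ.+ l) !) * ∫ π k (λ ys → mix ys l f) ∎
            where I = ∫ (prob p′) k (λ ys → mix ys l f)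

          diagonals : ∀ K → e⁻ᵐ * expTerm m K * 𝔼 p K f ≈ antidiagonal g K
          diagonals K = begin
            e⁻ᵐ * (m ^ K * 1/ K !) * 𝔼 p K f
              ≈⟨ *-congˡ (𝔼≈∫ p K f) ⟩
            e⁻ᵐ * (m ^ K * 1/ K !) * ∫ (prob p) K f
              ≈⟨ solve 4 (λ a b d e → a :* (b :* d) :* e := (a :* d) :* (b :* e)) refl e⁻ᵐ (m ^ K) (1/ K !) (∫ (prob p) K f) ⟩
            (e⁻ᵐ * 1/ K !) * (m ^ K * ∫ (prob p) K f)
              ≈⟨ *-congˡ (∫-scale m (prob p) K f) ⟨
            (e⁻ᵐ * 1/ K !) * ∫ (λ i → m * prob p i) K f
              ≈⟨ *-congˡ (∫-cong {k = K} mp≈ (λ _ → refl)) ⟩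
            (e⁻ᵐ * 1/ K !) * ∫ (λ i → ∑[ y < R ] (π y * w y i) + σ i) K f
              ≈⟨ *-congˡ (expand π K f) ⟩
            (e⁻ᵐ * 1/ K !) * antidiagonal (λ k l → ∫ π k (λ ys → mix ys l f)) K
              ≈⟨ antidiagonal-* (λ j → e⁻ᵐ * 1/ j !) _ K ⟨
            antidiagonal (λ k l → (e⁻ᵐ * 1/ (k ℕ.+ l) !) * ∫ π k (λ ys → mix ys l f)) K
              ≈⟨ antidiagonal-cong g≈ K ⟨
            antidiagonal g K ∎

          g-nonneg : ∀ k l → 0# ≤ g k l
          g-nonneg k l = *-nonneg (*-nonneg (exp-nonneg -m′⟶e⁻ᵐ′) (expTerm-nonneg 0≤m′ k))
            (∫-nonneg {k = k} (nonnegative p′) (λ ys → averageTerm-nonneg f 0≤f ys l))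

          rows : ∀ k → g k sumsTo (e⁻ᵐ′ * expTerm m′ k * 𝔼 p′ k average)
          rows k = ⟶-cong
            (λ L → trans (*-congˡ (∫-sum (prob p′) k {L} (λ l ys → averageTerm f ys (toℕ l))))
              (sym (∑<-* L (e⁻ᵐ′ * expTerm m′ k) (λ l → ∫ (prob p′) k (λ ys → averageTerm f ys l)))))
            (*-congˡ (sym (𝔼≈∫ p′ k average)))
            (⟶-* _ (∫-⟶ (prob p′) k average-sum))

  -- Grouping into buckets

  -- An element with bucket `nothing` is left out of all buckets; a function into `Maybe (Fin R)`
  -- makes buckets disjoint by construction.
  indicator : ∀ {R} → Maybe (Fin R) → Fin R → Carrier
  indicator nothing        _       = 0#
  indicator (just zero)    zero    = 1#
  indicator (just zero)    (suc y) = 0#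
  indicator (just (suc x)) zero    = 0#
  indicator (just (suc x)) (suc y) = indicator (just x) y

  indicator-nonneg : ∀ {R} (x : Maybe (Fin R)) y → 0# ≤ indicator x y
  indicator-nonneg nothing        _       = ≤-refl
  indicator-nonneg (just zero)    zero    = 0≤1
  indicator-nonneg (just zero)    (suc y) = ≤-refl
  indicator-nonneg (just (suc x)) zero    = ≤-refl
  indicator-nonneg (just (suc x)) (suc y) = indicator-nonneg (just x) y

  indicator-map-suc : ∀ {R} (x : Maybe (Fin R)) y → indicator (Maybe.map suc x) (suc y) ≈ indicator x y
  indicator-map-suc nothing  y = refl
  indicator-map-suc (just x) y = refl

  indicator-map-zero : ∀ {R} (x : Maybe (Fin R)) → indicator (Maybe.map suc x) zero ≈ 0#
  indicator-map-zero nothing  = refl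
  indicator-map-zero (just x) = refl

  select : ∀ {R} → Maybe (Fin R) → (Fin R → Carrier) → Carrier
  select nothing  u = 0#
  select (just y) u = u y

  sum-indicator : ∀ {R} (x : Maybe (Fin R)) u → ∑[ y < R ] (indicator x y * u y) ≈ select x u
  sum-indicator {R}     nothing  u = trans (sum-cong (λ y → zeroˡ (u y))) (sum-0 R)
  sum-indicator {suc R} (just zero) u = trans
    (+-cong (*-identityˡ _) (trans (sum-cong (λ y → zeroˡ (u (suc y)))) (sum-0 R))) (+-identityʳ _)
  sum-indicator {suc R} (just (suc x)) u = trans
    (+-cong (zeroˡ _) (sum-indicator (just x) (u ∘ suc))) (+-identityˡ _)

  module Buckets {lo hi : Carrier} (0<hi : 0# < hi) (lo<hi : lo < hi) where

    bucketMass : ∀ {n R} → (Fin n → Carrier) → (Fin n → Maybe (Fin R)) → Fin R → Carrier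
    bucketMass {n} v bucket y = ∑[ i < n ] (indicator (bucket i) y * v i)

    initial : ∀ {R} → Carrier → Fin R → Carrier
    initial b zero    = b
    initial b (suc _) = 0#

    initial-0 : ∀ {R} (y : Fin R) → initial 0# y ≈ 0#
    initial-0 zero    = refl
    initial-0 (suc y) = refl

    -- Bucket 0 is open and has mass b so far.  It is closed at mass > lo and kept
    -- open at mass < hi (two thresholds, as < is not decidable), so it never
    -- exceeds 2 hi.
    fill : ∀ {n} (v : Fin n → Carrier) R b → (∀ i → v i ≤ hi) → b < hi →
      fromℕ R * (hi + hi) ≤ b + sum v →
      ∃[ bucket ] (∀ y → lo ≤ initial {R} b y + bucketMass v bucket y)
    fill v zero b v≤hi b<hi enough = (λ _ → nothing) , λ ()
    -- No elements are left, yet the unfilled buckets would require mass at least 2 hi while b < hi.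
    fill {zero} v (suc R) b v≤hi b<hi enough = contradiction
      (<-≤-trans (≤-<-trans (≤-reflexive (+-identityʳ b)) b<hi) (≤-trans (x≤x+y (<⇒≤ 0<hi))
        (≤-by (*-nonneg (fromℕ-nonneg R) (+-nonneg (<⇒≤ 0<hi) (<⇒≤ 0<hi)))
          (solve 2 (λ r h → (con (1 , 0) :+ r) :* h := h :+ r :* h) refl (fromℕ R) (hi + hi)))))
      enough
    fill {suc n} v (suc R) b v≤hi b<hi enough with <-cotrans lo<hi (b + v zero)
    ... | inj₁ lo<b+v₀ = bucket , large
      where
      rest : ∃[ bucket ] (∀ y → lo ≤ initial {R} 0# y + bucketMass (v ∘ suc) bucket y)
      -- The closed bucket has used b + v₀ ≤ 2 hi, exactly the allowance by which the requirement
      -- drops from `suc R` to `R` buckets.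
      rest = fill (v ∘ suc) R 0# (v≤hi ∘ suc) 0<hi (≤-by
        (+-nonneg (x≤y⇒0≤y-x enough) (+-nonneg (x≤y⇒0≤y-x (<⇒≤ b<hi)) (x≤y⇒0≤y-x (v≤hi zero))))
        (solve 5 (λ r h b v S → con (0 , 0) :+ S :=
          r :* (h :+ h) :+ (((b :+ (v :+ S)) :- (con (1 , 0) :+ r) :* (h :+ h)) :+ ((h :- b) :+ (h :- v))))
          refl (fromℕ R) hi b (v zero) (sum (v ∘ suc))))
      bucket : Fin (suc n) → Maybe (Fin (suc R))
      bucket zero    = just zero
      bucket (suc i) = Maybe.map suc (proj₁ rest i)
      large : ∀ y → lo ≤ initial b y + bucketMass v bucket y
      large zero = ≤-trans (<⇒≤ lo<b+v₀) (≤-reflexive (+-congˡ (sym (trans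
        (+-cong (*-identityˡ _) (trans
          (sum-cong (λ i → trans (*-congʳ (indicator-map-zero (proj₁ rest i))) (zeroˡ _))) (sum-0 n)))
        (+-identityʳ _)))))
      large (suc y) = ≤-trans (proj₂ rest y) (≤-reflexive (+-cong (initial-0 y) (sym (trans
        (+-cong (zeroˡ _) (sum-cong (λ i → *-congʳ (indicator-map-suc (proj₁ rest i) y))))
        (+-identityˡ _)))))
    ... | inj₂ b+v₀<hi = bucket , large
      where
      rest : ∃[ bucket ] (∀ y → lo ≤ initial {suc R} (b + v zero) y + bucketMass (v ∘ suc) bucket y)
      rest = fill (v ∘ suc) (suc R) (b + v zero) (v≤hi ∘ suc) b+v₀<hi
        (≤-trans enough (≤-reflexive (sym (+-assoc _ _ _))))
      bucket : Fin (suc n) → Maybe (Fin (suc R))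
      bucket zero    = just zero
      bucket (suc i) = proj₁ rest i
      large : ∀ y → lo ≤ initial b y + bucketMass v bucket y
      large zero    = ≤-trans (proj₂ rest zero) (≤-reflexive
        (trans (+-assoc _ _ _) (+-congˡ (+-congʳ (sym (*-identityˡ _))))))
      large (suc y) = ≤-trans (proj₂ rest (suc y)) (≤-reflexive
        (+-congˡ (sym (trans (+-congʳ (zeroˡ _)) (+-identityˡ _)))))

    buckets : ∀ {n} (v : Fin n → Carrier) R → (∀ i → v i ≤ hi) → fromℕ R * (hi + hi) ≤ sum v →
      ∃[ bucket ] (∀ y → lo ≤ bucketMass {R = R} v bucket y)
    buckets v R v≤hi enough with fill v R 0# v≤hi 0<hi (≤-trans enough (x≤y+x ≤-refl))
    ... | bucket , large = bucket , λ y → ≤-trans (large y)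
      (≤-reflexive (trans (+-congʳ (initial-0 y)) (+-identityˡ _)))

  v≤max : ∀ {n} (v : Fin n → Carrier) i → v i ≤ foldr _⊔_ 0# v
  v≤max v zero    = proj₁ (⊔-supremum _ _)
  v≤max v (suc i) = ≤-trans (v≤max (v ∘ suc) i) (proj₁ (proj₂ (⊔-supremum _ _)))

  restrict≤prob : ∀ {n} (q : Distribution n) S i → restrict q S i ≤ prob q i
  restrict≤prob q S i with lookup S i
  ... | true  = ≤-refl
  ... | false = nonnegative q i

  x≤y/z⇒x*z≤y : ∀ {x y z} 0<z → x ≤ y / z [ 0<z ] → x * z ≤ y
  x≤y/z⇒x*z≤y {x} {y} {z} 0<z x≤y/z = ≤-trans (*-monoˡ-≤ (<⇒≤ 0<z) x≤y/z) (≤-reflexive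
    (trans (*-assoc _ _ _) (trans (*-congˡ (trans (*-comm _ _) (*-⁻¹ z 0<z))) (*-identityʳ y))))

  -- Buckets in S and lifted distributions

  module Reduction {n} (q : Distribution n) (S : Subset n) (R : ℕ) .{{_ : NonZero R}} (isR : IsR q S R) where

    Q : Carrier
    Q = mass q S

    0<Q : 0# < Q
    0<Q = mass-pos q S R isR

    v : Fin n → Carrier
    v = restrict q S

    0≤v : ∀ i → 0# ≤ v i
    0≤v = restrict-nonneg q S

    1/R : Carrier
    1/R = 1# / fromℕ R [ fromℕ-pos R ]

    R*1/R≈1 : fromℕ R * 1/R ≈ 1#
    R*1/R≈1 = trans (*-congˡ (*-identityˡ _)) (*-⁻¹ (fromℕ R) (fromℕ-pos R))

    0<1/R : 0# < 1/R
    0<1/R = inverse-pos R*1/R≈1 (fromℕ-pos R)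

    -- Here `hi` = Q/(2R) is the bound on single elements given by the floor, and R buckets of mass
    -- at most 2 `hi` fit exactly into Q. Any `lo` < `hi` would do for filling; half of `hi` gives θ
    -- = R `lo` = Q/4.
    θ hi lo : Carrier
    θ  = ½ * (½ * Q)
    hi = ½ * Q * 1/R
    lo = θ * 1/R

    0<θ : 0# < θ
    0<θ = *-pos 0<½ (*-pos 0<½ 0<Q)

    0<hi : 0# < hi
    0<hi = *-pos (*-pos 0<½ 0<Q) 0<1/R

    0<lo : 0# < lo
    0<lo = *-pos 0<θ 0<1/R

    lo<hi : lo < hi
    lo<hi = <-by 0<lo (sym (begin
      ½ * (½ * Q) * 1/R + ½ * (½ * Q) * 1/R
        ≈⟨ solve 3 (λ h Q r → h :* (h :* Q) :* r :+ h :* (h :* Q) :* r := (h :+ h) :* (h :* Q :* r)) refl ½ Q 1/R ⟩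
      (½ + ½) * hi ≈⟨ *-congʳ ½+½≈1 ⟩
      1# * hi      ≈⟨ *-identityˡ hi ⟩
      hi           ∎))
      where open SetoidReasoning setoid

    R*2hi≤Q : fromℕ R * (hi + hi) ≤ sum v
    R*2hi≤Q = ≤-reflexive (begin
      fromℕ R * (hi + hi)
        ≈⟨ solve 4 (λ n h Q r → n :* (h :* Q :* r :+ h :* Q :* r) := ((h :+ h) :* (n :* r)) :* Q) refl (fromℕ R) ½ Q 1/R ⟩
      ((½ + ½) * (fromℕ R * 1/R)) * Q  ≈⟨ *-congʳ (*-cong ½+½≈1 R*1/R≈1) ⟩
      (1# * 1#) * Q                    ≈⟨ trans (*-congʳ (*-identityˡ 1#)) (*-identityˡ Q) ⟩
      Q                                ∎)
      where open SetoidReasoning setoid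

    M≤hi : M q S ≤ hi
    M≤hi = begin
      M q S                                             ≈⟨ *-identityʳ _ ⟨
      M q S * 1#                                        ≈⟨ *-congˡ (*-⁻¹ (fromℕ 2) (fromℕ-pos 2)) ⟨
      M q S * (fromℕ 2 * ½)                             ≈⟨ *-identityʳ _ ⟨
      M q S * (fromℕ 2 * ½) * 1#                        ≈⟨ *-congˡ R*1/R≈1 ⟨
      M q S * (fromℕ 2 * ½) * (fromℕ R * 1/R)
        ≈⟨ solve 5 (λ M t h n r → M :* (t :* h) :* (n :* r) := (n :* (t :* M)) :* (h :* r)) refl (M q S) (fromℕ 2) ½ (fromℕ R) 1/R ⟩
      (fromℕ R * (fromℕ 2 * M q S)) * (½ * 1/R)
        ≤⟨ *-monoˡ-≤ (<⇒≤ (*-pos 0<½ 0<1/R)) (x≤y/z⇒x*z≤y _ (proj₁ (proj₂ isR))) ⟩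
      Q * (½ * 1/R)                                     ≈⟨ solve 3 (λ Q h r → Q :* (h :* r) := h :* Q :* r) refl Q ½ 1/R ⟩
      hi                                                ∎
      where open ≤-Reasoning

    open Buckets 0<hi lo<hi

    partition : ∃[ bucket ] (∀ y → lo ≤ bucketMass {R = R} v bucket y)
    partition = buckets v R (λ i → ≤-trans (v≤max v i) M≤hi) R*2hi≤Q

    bucket : Fin n → Maybe (Fin R)
    bucket = proj₁ partition

    b : Fin R → Carrier
    b = bucketMass v bucket

    lo≤b : ∀ y → lo ≤ b y
    lo≤b = proj₂ partition

    0<b : ∀ y → 0# < b y
    0<b y = <-≤-trans 0<lo (lo≤b y)

    1/b : Fin R → Carrier
    1/b y = b y ⁻¹[ 0<b y ]

    0≤1/b : ∀ y → 0# ≤ 1/b y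
    0≤1/b y = <⇒≤ (⁻¹-pos (b y) (0<b y))

    w : Fin R → Fin n → Carrier
    w y i = indicator (bucket i) y * v i * 1/b y

    0≤w : ∀ y i → 0# ≤ w y i
    0≤w y i = *-nonneg (*-nonneg (indicator-nonneg (bucket i) y) (0≤v i)) (0≤1/b y)

    ∑w≈1 : ∀ y → sum (w y) ≈ 1#
    ∑w≈1 y = trans (sum-*ʳ _ (λ i → indicator (bucket i) y * v i)) (*-⁻¹ (b y) (0<b y))

    sum-w : ∀ (x : Fin R → Carrier) i → ∑[ y < R ] (x y * w y i) ≈ select (bucket i) (λ y → x y * (v i * 1/b y))
    sum-w x i = trans
      (sum-cong (λ y → solve 4 (λ x d v b → x :* (d :* v :* b) := d :* (x :* (v :* b))) refl
        (x y) (indicator (bucket i) y) (v i) (1/b y)))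
      (sum-indicator (bucket i) (λ y → x y * (v i * 1/b y)))

    -- By disjointness at most one summand is nonzero at `i`, so nothing cancels; hence distances
    -- scale exactly instead of merely contracting.
    ∣sum-w∣ : ∀ (x : Fin R → Carrier) i → ∣ ∑[ y < R ] (x y * w y i) ∣ ≈ ∑[ y < R ] (∣ x y ∣ * w y i)
    ∣sum-w∣ x i = trans (∣∣-cong (sum-w x i)) (trans (∣select∣ (bucket i)) (sym (sum-w (λ y → ∣ x y ∣) i)))
      where
      ∣select∣ : ∀ c → ∣ select c (λ y → x y * (v i * 1/b y)) ∣ ≈ select c (λ y → ∣ x y ∣ * (v i * 1/b y))
      ∣select∣ nothing  = 0≤x⇒∣x∣≈x ≤-refl
      ∣select∣ (just y) = trans (∣∣-cong (*-comm _ _))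
        (trans (0≤x⇒∣x*y∣≈x*∣y∣ (*-nonneg (0≤v i) (0≤1/b y)) (x y)) (*-comm _ _))

    sum-sum-w : ∀ (x : Fin R → Carrier) → ∑[ i < n ] ∑[ y < R ] (x y * w y i) ≈ sum x
    sum-sum-w x = trans (sum-swap (λ i y → x y * w y i))
      (sum-cong (λ y → trans (sum-*ˡ (x y) (w y)) (trans (*-congˡ (∑w≈1 y)) (*-identityʳ (x y)))))

    -- What remains of q once its uniform mixture of buckets is taken out: the part common to all
    -- lifts, and after scaling by m the noise intensity.
    ρ : Fin n → Carrier
    ρ i = prob q i - θ * ∑[ y < R ] (1/R * w y i)

    0≤ρ : ∀ i → 0# ≤ ρ i
    0≤ρ i = x≤y⇒0≤y-x (≤-trans
      (≤-respˡ-≈ (*-congˡ (sym (sum-w (λ _ → 1/R) i))) (bound (bucket i)))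
      (restrict≤prob q S i))
      where
      bound : ∀ c → θ * select c (λ y → 1/R * (v i * 1/b y)) ≤ v i
      bound nothing  = ≤-trans (≤-reflexive (zeroʳ θ)) (0≤v i)
      bound (just y) = begin
        θ * (1/R * (v i * 1/b y))
          ≈⟨ solve 4 (λ t r v b → t :* (r :* (v :* b)) := (t :* r) :* (v :* b)) refl θ 1/R (v i) (1/b y) ⟩
        lo * (v i * 1/b y)   ≤⟨ *-monoˡ-≤ (*-nonneg (0≤v i) (0≤1/b y)) (lo≤b y) ⟩
        b y * (v i * 1/b y)  ≈⟨ solve 3 (λ b v c → b :* (v :* c) := v :* (b :* c)) refl (b y) (v i) (1/b y) ⟩
        v i * (b y * 1/b y)  ≈⟨ trans (*-congˡ (*-⁻¹ (b y) (0<b y))) (*-identityʳ (v i)) ⟩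
        v i                  ∎
        where open ≤-Reasoning

    module _ (p′ : Distribution R) where

      mixture : Fin n → Carrier
      mixture i = ∑[ y < R ] (prob p′ y * w y i)

      difference : Fin R → Carrier
      difference y = prob p′ y - 1/R

      -- Written as two nonnegative parts, with p′ in the second only, which is the form that
      -- Poisson splitting takes apart.
      lifted : Fin n → Carrier
      lifted i = ρ i + θ * mixture i

      lifted-q : ∀ i → lifted i - prob q i ≈ θ * ∑[ y < R ] (difference y * w y i)
      lifted-q i = trans
        (solve 4 (λ q t u m → (q :- t :* u :+ t :* m) :- q := t :* (m :+ :- u)) refl
          (prob q i) θ (∑[ y < R ] (1/R * w y i)) (mixture i))
        (*-congˡ (sym (begin
          ∑[ y < R ] (difference y * w y i)
            ≈⟨ sum-cong (λ y → solve 3 (λ p r w → (p :- r) :* w := p :* w :+ (:- con (1 , 0)) :* (r :* w)) refl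
                 (prob p′ y) 1/R (w y i)) ⟩
          ∑[ y < R ] (prob p′ y * w y i + - 1# * (1/R * w y i))  ≈⟨ sum-+ {R} _ _ ⟩
          mixture i + ∑[ y < R ] (- 1# * (1/R * w y i))          ≈⟨ +-congˡ (sum-*ˡ {R} (- 1#) _) ⟩
          mixture i + - 1# * ∑[ y < R ] (1/R * w y i)            ≈⟨ +-congˡ (RP.-1*x≈-x _) ⟩
          mixture i - ∑[ y < R ] (1/R * w y i)                   ∎)))
        where open SetoidReasoning setoid

      lifted-total : sum lifted ≈ 1#
      lifted-total = begin
        sum lifted
          ≈⟨ sum-cong (λ i → solve 3 (λ q u m → q :- u :+ m := q :+ (m :+ (:- con (1 , 0)) :* u)) refl
               (prob q i) (θ * ∑[ y < R ] (1/R * w y i)) (θ * mixture i)) ⟩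
        ∑[ i < n ] (prob q i + (θ * mixture i + - 1# * (θ * ∑[ y < R ] (1/R * w y i))))
          ≈⟨ trans (sum-+ {n} _ _) (+-congˡ (sum-+ {n} _ _)) ⟩
        sum (prob q) + (∑[ i < n ] (θ * mixture i) + ∑[ i < n ] (- 1# * (θ * ∑[ y < R ] (1/R * w y i))))
          ≈⟨ +-congˡ (+-cong (sum-*ˡ θ mixture) (trans (sum-*ˡ {n} (- 1#) _) (*-congˡ (sum-*ˡ {n} θ _)))) ⟩
        sum (prob q) + (θ * sum mixture + - 1# * (θ * ∑[ i < n ] ∑[ y < R ] (1/R * w y i)))
          ≈⟨ +-cong (total q) (+-cong (*-congˡ (trans (sum-sum-w (prob p′)) (total p′)))
               (*-congˡ (*-congˡ (trans (sum-sum-w (λ _ → 1/R)) (total (Unif R)))))) ⟩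
        1# + (θ * 1# + - 1# * (θ * 1#))
          ≈⟨ solve 2 (λ i t → i :+ (t :+ (:- con (1 , 0)) :* t) := i) refl 1# (θ * 1#) ⟩
        1# ∎
        where open SetoidReasoning setoid

      p : Distribution n
      p = record
        { prob        = lifted
        ; nonnegative = λ i → +-nonneg (0≤ρ i) (*-nonneg (<⇒≤ 0<θ)
            (sum-nonneg _ (λ y → *-nonneg (nonnegative p′ y) (0≤w y i))))
        ; total       = lifted-total
        }

      ‖p-q‖ : ‖ p - q ‖₁ ≈ θ * ‖ p′ - Unif R ‖₁
      ‖p-q‖ = begin
        ∑[ i < n ] ∣ lifted i - prob q i ∣
          ≈⟨ sum-cong (λ i → trans (∣∣-cong (lifted-q i)) (trans (0≤x⇒∣x*y∣≈x*∣y∣ (<⇒≤ 0<θ) _) (*-congˡ (∣sum-w∣ difference i)))) ⟩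
        ∑[ i < n ] (θ * ∑[ y < R ] (∣ difference y ∣ * w y i))
          ≈⟨ sum-*ˡ {n} θ _ ⟩
        θ * ∑[ i < n ] ∑[ y < R ] (∣ difference y ∣ * w y i)
          ≈⟨ *-congˡ (sum-sum-w (λ y → ∣ difference y ∣)) ⟩
        θ * ‖ p′ - Unif R ‖₁ ∎
        where open SetoidReasoning setoid

    4/Q : Carrier
    4/Q = fromℕ 4 / Q [ 0<Q ]

    4/Q*θ≈1 : 4/Q * θ ≈ 1#
    4/Q*θ≈1 = begin
      4/Q * θ
        ≈⟨ *-congʳ (*-congʳ (fromℕ-* 2 2)) ⟩
      fromℕ 2 * fromℕ 2 * Q⁻¹ * (½ * (½ * Q))
        ≈⟨ solve 4 (λ t h Q i → t :* t :* i :* (h :* (h :* Q)) := (t :* h) :* (t :* h) :* (Q :* i)) refl (fromℕ 2) ½ Q Q⁻¹ ⟩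
      (fromℕ 2 * ½) * (fromℕ 2 * ½) * (Q * Q⁻¹)
        ≈⟨ *-cong (*-cong (*-⁻¹ _ _) (*-⁻¹ _ _)) (*-⁻¹ Q 0<Q) ⟩
      1# * 1# * 1#
        ≈⟨ trans (*-identityʳ _) (*-identityʳ _) ⟩
      1# ∎
      where
      open SetoidReasoning setoid
      Q⁻¹ = Q ⁻¹[ 0<Q ]

    θ*4ε/Q≈ε : ∀ ε → θ * (fromℕ 4 * ε / Q [ 0<Q ]) ≈ ε
    θ*4ε/Q≈ε ε = trans (solve 4 (λ t f e i → t :* (f :* e :* i) := (f :* i :* t) :* e) refl θ (fromℕ 4) ε (Q ⁻¹[ 0<Q ]))
      (trans (*-congʳ 4/Q*θ≈1) (*-identityˡ ε))

    -- The tester for the uniform distribution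

    module _ {m : Carrier} (0≤m : 0# ≤ m) (T : Tester n) where

      σ : Fin n → Carrier
      σ i = m * ρ i

      open Poissonize w σ 0≤w ∑w≈1 (λ i → *-nonneg 0≤m (0≤ρ i))

      reject≥0 : ∀ {k} (xs : Vec (Fin n) k) → 0# ≤ reject T xs
      reject≥0 xs = x≤y⇒0≤y-x (accept≤1 T xs)

      reject≤1 : ∀ {k} (xs : Vec (Fin n) k) → reject T xs ≤ 1#
      reject≤1 xs = ≤-by (accept≥0 T xs) (solve 2 (λ o a → o := o :- a :+ a) refl 1# (accept T xs))

      module Accept = Average (accept T) (accept≥0 T) (accept≤1 T)
      module Reject = Average (reject T) reject≥0 reject≤1

      T′ : Tester R
      T′ = record
        { accept   = Accept.average
        ; accept≥0 = Accept.average-nonneg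
        ; accept≤1 = Accept.average≤1
        }

      -- Poisson splitting yields the average of `reject T`, whereas `T′` rejects with the
      -- complement of its averaged acceptance. They agree since the two averages add up to the
      -- average of 1, which is 1.
      reject-average : ∀ {k} (ys : Vec (Fin R) k) → Reject.average ys ≈ reject T′ ys
      reject-average ys = trans
        (solve 2 (λ a r → r := (a :+ r) :- a) refl (Accept.average ys) (Reject.average ys))
        (+-congʳ (⟶-unique (⟶-+ (Accept.average-sum ys) (Reject.average-sum ys))
          (⟶-cong (λ L → trans (∑<-cong L (λ l → sym (averageTerm-+ (accept T) (reject T) (λ _ → 1#)
              (λ xs → solve 2 (λ x y → x :+ (y :- x) := y) refl (accept T xs) 1#) ys l)))
            (∑<-+ L (averageTerm (accept T) ys) (averageTerm (reject T) ys)))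
            refl (averageTerm-1-sum ys))))

      module _ (p′ : Distribution R) where

        intensities : ∀ i → m * lifted p′ i ≈ ∑[ y < R ] (m * θ * prob p′ y * w y i) + σ i
        intensities i = trans
          (solve 4 (λ m r t x → m :* (r :+ t :* x) := (m :* t) :* x :+ m :* r) refl m (ρ i) θ (mixture p′ i))
          (+-congʳ (trans (sym (sum-*ˡ (m * θ) (λ y → prob p′ y * w y i)))
            (sum-cong (λ y → sym (*-assoc (m * θ) (prob p′ y) (w y i))))))

        0≤mθ : 0# ≤ m * θ
        0≤mθ = *-nonneg 0≤m (<⇒≤ 0<θ)

        accepts : ∀ {a} → AcceptsWithProb T m (p p′) a → AcceptsWithProb T′ (m * θ) p′ a
        accepts = Accept.poissonize (p p′) p′ 0≤mθ intensities

        rejects : ∀ {a} → RejectsWithProb T m (p p′) a → RejectsWithProb T′ (m * θ) p′ a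
        rejects {a} h = let e , isExp , sums = Reject.poissonize (p p′) p′ 0≤mθ intensities h in e , isExp , ⟶-cong
          (λ N → ∑<-cong N (λ k → *-congˡ {x = e * expTerm (m * θ) k} (trans (𝔼≈∫ p′ k Reject.average) (trans
            (∫-cong {k = k} (λ _ → refl) reject-average) (sym (𝔼≈∫ p′ k (reject T′)))))))
          refl sums

    suffices : ∀ {ε₁ ε₂ δ m} → Suffices q ε₁ ε₂ δ m →
      Suffices (Unif R) (fromℕ 4 * ε₁ / Q [ 0<Q ]) (fromℕ 4 * ε₂ / Q [ 0<Q ]) δ (m * θ)
    suffices {ε₁} {ε₂} {δ} {m} (0≤m , T , distinguishes) =
      *-nonneg 0≤m (<⇒≤ 0<θ) , T′ 0≤m T , λ p′ →
        (λ d≤ε → let a , acc , 1-δ≤a = proj₁ (distinguishes (p p′)) (close p′ d≤ε)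
                 in a , accepts 0≤m T p′ acc , 1-δ≤a) ,
        (λ ε≤d → let r , rej , 1-δ≤r = proj₂ (distinguishes (p p′)) (far p′ ε≤d)
                 in r , rejects 0≤m T p′ rej , 1-δ≤r)
      where
      open ≤-Reasoning
      close : ∀ p′ → ‖ p′ - Unif R ‖₁ ≤ fromℕ 4 * ε₁ / Q [ 0<Q ] → ‖ p p′ - q ‖₁ ≤ ε₁
      close p′ d≤ε = begin
        ‖ p p′ - q ‖₁                    ≈⟨ ‖p-q‖ p′ ⟩
        θ * ‖ p′ - Unif R ‖₁             ≤⟨ *-monoʳ-≤ (<⇒≤ 0<θ) d≤ε ⟩
        θ * (fromℕ 4 * ε₁ / Q [ 0<Q ])   ≈⟨ θ*4ε/Q≈ε ε₁ ⟩
        ε₁                               ∎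
      far : ∀ p′ → fromℕ 4 * ε₂ / Q [ 0<Q ] ≤ ‖ p′ - Unif R ‖₁ → ε₂ ≤ ‖ p p′ - q ‖₁
      far p′ ε≤d = begin
        ε₂                               ≈⟨ θ*4ε/Q≈ε ε₂ ⟨
        θ * (fromℕ 4 * ε₂ / Q [ 0<Q ])   ≤⟨ *-monoʳ-≤ (<⇒≤ 0<θ) ε≤d ⟩
        θ * ‖ p′ - Unif R ‖₁             ≈⟨ ‖p-q‖ p′ ⟨
        ‖ p p′ - q ‖₁                    ∎

    SC-≽ : ∀ {ε₁ ε₂ δ} → SC q ε₁ ε₂ δ ≽
      4/Q ∙ SC (Unif R) (fromℕ 4 * ε₁ / Q [ 0<Q ]) (fromℕ 4 * ε₂ / Q [ 0<Q ]) δ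
    SC-≽ {x = r} (m , m-suffices , m<r) =
      -- As θ is the inverse of `4/Q`, the number to be scaled back to `r` is `r * θ`; it stays
      -- strictly above the sufficient `m * θ`.
      r * θ , (m * θ , suffices m-suffices , *-monoˡ-< 0<θ m<r) ,
      sym (trans (solve 3 (λ k r t → k :* (r :* t) := (k :* t) :* r) refl 4/Q r θ) (trans (*-congʳ 4/Q*θ≈1) (*-identityˡ r)))

theoremC1 : ∀ {c ℓ₁ ℓ₂} (ℝ : Reals c ℓ₁ ℓ₂) → let open IdentityTesting ℝ in
  ∀ {n : ℕ} (q : Distribution n) (S : Subset n) → Nonempty S →
  (R : ℕ) .{{_ : NonZero R}} (isR : IsR q S R) →
  (ε₁ ε₂ δ : Carrier) → 0# ≤ ε₁ → ε₁ < ε₂ → 0# < δ →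
  let
    q⟨S⟩   = mass q S
    0<q⟨S⟩ = mass-pos q S R isR
  in
  SC q ε₁ ε₂ δ
    ≽
  (fromℕ 4 / q⟨S⟩ [ 0<q⟨S⟩ ])
    ∙ SC (Unif R) (fromℕ 4 * ε₁ / q⟨S⟩ [ 0<q⟨S⟩ ]) (fromℕ 4 * ε₂ / q⟨S⟩ [ 0<q⟨S⟩ ]) δ
theoremC1 ℝ q S _ R isR _ _ _ _ _ _ = Reduction.SC-≽ ℝ q S R isR
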